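{- Let $n=4k+r$ with integers $k\ge 0$ and $0\le r<4$. Then $${\rm ord}_2(t_n)=k+\left\lfloor \tfrac r2\right\rfloor+\delta_{r,3}=\left\lfloor\tfrac n2\right\rfloor-2\left\lfloor\tfrac n4\right\rfloor+\left\lfloor\tfrac{n+1}4\right\rfloor,$$ and the odd factor $\beta_n=t_n/2^{{\rm ord}_2(t_n)}$ satisfies $$\beta_n=\sum_{i=0}^{k}2^{i-\delta_{r,3}}\binom{k}{i}\frac{(1;2)_{k+\lfloor r/2\rfloor}}{(1;2)_{i+\lfloor r/2\rfloor}}\,g_{4i+r}.$$
   Context: $t_n$ is the number of involutions of $[n]$ ($t_0=1$); ${\rm ord}_2(m)$ is the largest $e$ with $2^e\mid m$; $\delta_{r,3}=1$ if $r=3$ and $0$ otherwise. $(a;b)_m=\prod_{j=0}^{m-1}(a+jb)$. For $m=2u+\rho$ with $\rho\in\{0,1\}$, let $V_m=\{v_1,\dots,v_u\}$ if $\rho=0$ and $\{v_1,\dots,v_{u+1}\}$ if $\rho=1$; $\mathfrak{G}_m$ is the set of loopless multigraphs on $V_m$ with all degrees at most $2$, $v_{u+1}$ (if present) of degree at most $1$, and all edge multiplicities at most $2$; $g_m$ is the number of graphs in $\mathfrak{G}_m$ with no edge of multiplicity $2$. -}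

module Defs where

open import Data.Nat using (ℕ; zero; suc; _+_; _*_; _∸_; _^_; _≤ᵇ_; _≡ᵇ_; _<ᵇ_; NonZero)
open import Data.Nat.Properties using (m*n≢0; m^n≢0)
open import Data.Nat.Divisibility using (_∣_)
open import Data.Nat.DivMod using (_/_; _%_)
open import Data.Nat.Combinatorics using (_C_)
open import Data.Fin using (Fin; toℕ)
open import Data.Fin.Properties using (all?; _≟_)
open import Data.Vec using (Vec; []; _∷_; lookup)
open import Data.List using (List; []; _∷_; length; filter; filterᵇ; map; concatMap; allFin; upTo; zip; foldr)
open import Data.Nat.ListAction using (sum)
open import Data.Bool.ListAction using (all)
open import Data.Product using (_×_; _,_; proj₁; proj₂)
open import Data.Bool using (Bool; true; false; _∧_; _∨_; not; if_then_else_)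
open import Relation.Binary.PropositionalEquality using (_≡_)
open import Data.Integer using (+_)
open import Data.Rational using (ℚ; 0ℚ) renaming (_/_ to _/ℚ_; _+_ to _+ℚ_; _*_ to _*ℚ_)

vecs : {A : Set} → List A → (m : ℕ) → List (Vec A m)
vecs xs zero = [] ∷ []
vecs xs (suc m) = concatMap (λ x → map (x ∷_) (vecs xs m)) xs

IsInvolution : {n : ℕ} → Vec (Fin n) n → Set
IsInvolution {n} f = ∀ i → lookup f (lookup f i) ≡ i

involutions : (n : ℕ) → List (Vec (Fin n) n)
involutions n = filter (λ f → all? (λ i → lookup f (lookup f i) ≟ i)) (vecs (allFin n) n)

t : ℕ → ℕ
t n = length (involutions n)

IsOrd2 : ℕ → ℕ → Set
IsOrd2 m e = (2 ^ e ∣ m) × (∀ e′ → 2 ^ e′ ∣ m → e′ Data.Nat.≤ e)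

δ3 : ℕ → ℕ
δ3 3 = 1
δ3 _ = 0

poch : ℕ → ℕ → ℕ → ℕ
poch a b zero = 1
poch a b (suc m) = poch a b m * (a + m * b)

poch12-nonZero : ∀ m → NonZero (poch 1 2 m)
poch12-nonZero zero = _
poch12-nonZero (suc m) = m*n≢0 (poch 1 2 m) (1 + m * 2) {{poch12-nonZero m}}

-- Vertex set V_m = {v_1,…,v_N}, N = u + ρ, m = 2u + ρ; vertex v_{j+1} is Fin index j.
numV : ℕ → ℕ
numV m = m / 2 + m % 2

pairs : (N : ℕ) → List (Fin N × Fin N)
pairs N = concatMap (λ i → filterᵇ (λ p → toℕ (proj₁ p) <ᵇ toℕ (proj₂ p)) (map (i ,_) (allFin N))) (allFin N)

-- a loopless multigraph with edge multiplicities ≤ 2 on V_m: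
-- a multiplicity in {0,1,2} for every pair in (pairs (numV m))
MGraph : ℕ → Set
MGraph m = Vec (Fin 3) (length (pairs (numV m)))

allMGraphs : (m : ℕ) → List (MGraph m)
allMGraphs m = vecs (allFin 3) (length (pairs (numV m)))

edgeList : (m : ℕ) → MGraph m → List ((Fin (numV m) × Fin (numV m)) × ℕ)
edgeList m G = zip (pairs (numV m)) (map toℕ (Data.Vec.toList G))

degree : (m : ℕ) → MGraph m → Fin (numV m) → ℕ
degree m G v = sum (map (λ e → if (toℕ (proj₁ (proj₁ e)) ≡ᵇ toℕ v) ∨ (toℕ (proj₂ (proj₁ e)) ≡ᵇ toℕ v) then proj₂ e else 0) (edgeList m G))

-- membership in 𝔊_m: all degrees ≤ 2, and v_{u+1} (index u = m/2, present iff m odd) has degree ≤ 1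
inG : (m : ℕ) → MGraph m → Bool
inG m G = all (λ v → (degree m G v ≤ᵇ 2) ∧ (not (toℕ v ≡ᵇ m / 2) ∨ (degree m G v ≤ᵇ 1))) (allFin (numV m))

𝔊 : (m : ℕ) → List (MGraph m)
𝔊 m = filterᵇ (inG m) (allMGraphs m)

noDoubleEdge : (m : ℕ) → MGraph m → Bool
noDoubleEdge m G = all (λ x → not (toℕ x ≡ᵇ 2)) (Data.Vec.toList G)

g : ℕ → ℕ
g m = length (filterᵇ (noDoubleEdge m) (𝔊 m))

sumTo : ℕ → (ℕ → ℚ) → ℚ
sumTo k f = foldr _+ℚ_ 0ℚ (map f (upTo (suc k)))

βterm : ℕ → ℕ → ℕ → ℚ
βterm k r i =
  (((+ (2 ^ i)) /ℚ (2 ^ δ3 r)) {{m^n≢0 2 (δ3 r)}}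
   *ℚ ((+ (k C i)) /ℚ 1))
   *ℚ (((+ poch 1 2 (k + r / 2)) /ℚ poch 1 2 (i + r / 2)) {{poch12-nonZero (i + r / 2)}}
   *ℚ ((+ g (4 * i + r)) /ℚ 1))

βrat : ℕ → ℕ → ℚ
βrat n e = ((+ t n) /ℚ (2 ^ e)) {{m^n≢0 2 e}}

{-# OPTIONS --safe #-}
module Submission where

-- Group 2u + ρ points into u pairs and ρ singletons and collapse each group to a vertex: an involution becomes a
-- multigraph in 𝔊_{2u+ρ}, and a multigraph with d double edges arises from 2^(u-d) involutions. Summing over the
-- matchings formed by the double edges gives t_{2u+ρ} = Σ_j C(u,2j) (2j-1)!! 2^(u-j) g_{2(u-2j)+ρ}.
-- This identity is obtained from recurrences. Let γ p q count the simple graphs on p vertices of degree at most 2 and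
-- q vertices of degree at most 1. Deleting a vertex of the first kind gives a recurrence in p, and t_{2p+q} satisfies
-- the transformed recurrence because t_{n+1} = t_n + n t_{n-1}. Deleting a vertex of the second kind gives a recurrence
-- in q, which for p > 0 has to agree with the one in p; this follows since the sum over matchings is an injective
-- transform of γ.

open import Defs
open import Data.Bool using (Bool; true; false; T; _∧_; _∨_; not; if_then_else_)
import Data.Bool.Properties as Bool
open import Data.Bool.ListAction using (all)
open import Data.Empty using (⊥; ⊥-elim)
open import Data.Fin using (Fin; zero; suc; toℕ; punchIn; punchOut)
import Data.Fin.Properties as Fin
import Data.Integer as ℤ
import Data.Integer.Properties as ℤ
open import Data.List using (List; []; _∷_; _++_; length; filterᵇ; map; concatMap; cartesianProductWith; zip; foldr; applyUpTo; allFin)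
import Data.List as List
import Data.List.Properties as List
open import Data.List.Membership.Propositional using (_∈_)
open import Data.List.Membership.Propositional.Properties
open import Data.List.Membership.Propositional.Properties.WithK using (unique∧set⇒bag)
open import Data.List.Relation.Binary.BagAndSetEquality using (∼bag⇒↭)
open import Data.List.Relation.Binary.Permutation.Propositional.Properties using (↭-length)
open import Data.List.Relation.Unary.All using ([])
import Data.List.Relation.Unary.All as ListAll
import Data.List.Relation.Unary.All.Properties as ListAll
open import Data.List.Relation.Unary.AllPairs using ([]; _∷_)
open import Data.List.Relation.Unary.Any using (here)
open import Data.List.Relation.Unary.Unique.Propositional using (Unique)
import Data.List.Relation.Unary.Unique.Propositional.Properties as Unique
open import Data.Nat using (ℕ; zero; suc; pred; _+_; _*_; _∸_; _^_; _≤_; _<_; z≤n; s≤s; _≤ᵇ_; _<ᵇ_; _≡ᵇ_; NonZero)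
open import Data.Nat.Combinatorics using (_C_; nCk+nC[k+1]≡[n+1]C[k+1])
open import Data.Nat.Divisibility using (_∣_; divides; ∣-trans; m∣m*n; ∣m+n∣m⇒∣n; *-cancelˡ-∣; ∣1⇒≡1)
open import Data.Nat.DivMod using (_/_; _%_; m%n<n; m<n⇒m/n≡0; m<n⇒m%n≡m; m*n/n≡m; +-distrib-/-∣ʳ; [m+kn]%n≡m%n)
open import Data.Nat.Induction using (<-rec)
open import Data.Nat.ListAction using (sum)
open import Data.Nat.Properties
open import Data.Nat.Tactic.RingSolver using (solve-∀)
open import Data.Product using (Σ; ∃; _×_; _,_; proj₁; proj₂)
open import Data.Rational using (ℚ; 0ℚ; fromℚᵘ) renaming (_/_ to _/ℚ_; _+_ to _+ℚ_; _*_ to _*ℚ_)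
import Data.Rational.Properties as ℚ
import Data.Rational.Unnormalised as ℚᵘ
import Data.Rational.Unnormalised.Properties as ℚᵘ
open import Data.Sum using (inj₁; inj₂)
open import Data.Unit using (tt)
open import Data.Vec using (Vec; []; _∷_; lookup; tabulate; insertAt; tail; toList)
import Data.Vec as Vec
import Data.Vec.Properties as Vec
open import Data.Vec.Relation.Unary.All using (All; []; _∷_)
open import Function using (_∘_; const; id; mk⇔; Equivalence)
open import Relation.Nullary using (¬_; yes; no)
open import Relation.Binary.PropositionalEquality using (_≡_; refl; sym; trans; cong; cong₂; subst; module ≡-Reasoning)

-- Sums over matchings and the recurrence of γ


-- The exponent u - d: a factor 2 belongs to each pair, since its points may be exchanged or, for an
-- isolated vertex, both fixed or swapped; the two ends of a double edge share one such factor.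
-- Graphs are counted along a fixed order of the vertices. Deleting a vertex lowers the bounds of
-- its neighbours, so a vertex of degree at most 1 can come up anywhere in that order. This is why
-- both recurrences are needed although only one can define `γ`. An involution of q points is also a
-- graph of maximum degree 1 on them, hence `γ 0 = τ`. Powers of 2: let u = 2k + s with s at most 1.
-- A matching that leaves 2i + s vertices unmatched has k - i edges and weight 2^(k+s+i), so 2^(k+s)
-- comes out of the sum and 2^i stays with the summand i. The summand i = 0 is an odd coefficient
-- times g_r, and g_0 = g_1 = g_2 = 1. For r = 3 it is g_3 = 2 that raises the order by one, and by
-- no more because g_7 = 26 makes the summand i = 1 divisible by 4.

τ : ℕ → ℕ
τ 0 = 1
τ 1 = 1
τ (suc (suc n)) = τ (suc n) + suc n * τ n

τ-suc : ∀ n → τ (suc n) ≡ τ n + n * τ (pred n)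
τ-suc zero    = refl
τ-suc (suc n) = refl

-- Sums 2^(p - #edges) f(#unmatched vertices) over the matchings of p vertices.
matchSum : ℕ → (ℕ → ℕ) → ℕ
matchSum 0 f = f 0
matchSum 1 f = 2 * f 1
matchSum (suc (suc p)) f = 2 * matchSum (suc p) (f ∘ suc) + 2 * suc p * matchSum p f

matchSum-suc : ∀ p f → matchSum (suc p) f ≡ 2 * matchSum p (f ∘ suc) + 2 * p * matchSum (pred p) f
matchSum-suc zero    f = sym (+-identityʳ _)
matchSum-suc (suc p) f = refl

matchSum-cong-≤ : ∀ p {f h} → (∀ m → m ≤ p → f m ≡ h m) → matchSum p f ≡ matchSum p h
matchSum-cong-≤ 0 eq = eq 0 z≤n
matchSum-cong-≤ 1 eq = cong (2 *_) (eq 1 ≤-refl)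
matchSum-cong-≤ (suc (suc p)) eq = cong₂ (λ x y → 2 * x + 2 * suc p * y)
  (matchSum-cong-≤ (suc p) (λ m m≤ → eq (suc m) (s≤s m≤)))
  (matchSum-cong-≤ p (λ m m≤ → eq m (≤-trans m≤ (m≤n+m p 2))))

matchSum-cong : ∀ p {f h} → (∀ m → f m ≡ h m) → matchSum p f ≡ matchSum p h
matchSum-cong p eq = matchSum-cong-≤ p (λ m _ → eq m)

matchSum-+ : ∀ p f h → matchSum p (λ m → f m + h m) ≡ matchSum p f + matchSum p h
matchSum-+ 0 f h = refl
matchSum-+ 1 f h = *-distribˡ-+ 2 (f 1) (h 1)
matchSum-+ (suc (suc p)) f h
  rewrite matchSum-+ (suc p) (f ∘ suc) (h ∘ suc) | matchSum-+ p f h = lemma (matchSum (suc p) (f ∘ suc)) (matchSum (suc p) (h ∘ suc)) (2 * suc p) (matchSum p f) (matchSum p h)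
  where
  lemma : ∀ a b c d e → 2 * (a + b) + c * (d + e) ≡ (2 * a + c * d) + (2 * b + c * e)
  lemma = solve-∀

matchSum-* : ∀ p c f → matchSum p (λ m → c * f m) ≡ c * matchSum p f
matchSum-* 0 c f = refl
matchSum-* 1 c f = lemma c (f 1)
  where
  lemma : ∀ c x → 2 * (c * x) ≡ c * (2 * x)
  lemma = solve-∀
matchSum-* (suc (suc p)) c f
  rewrite matchSum-* (suc p) c (f ∘ suc) | matchSum-* p c f = lemma c (matchSum (suc p) (f ∘ suc)) (2 * suc p) (matchSum p f)
  where
  lemma : ∀ c x k y → 2 * (c * x) + k * (c * y) ≡ c * (2 * x + k * y)
  lemma = solve-∀

pred-irr : ∀ m (f : ℕ → ℕ) → m * f (suc (pred m)) ≡ m * f m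
pred-irr zero    f = refl
pred-irr (suc m) f = refl

-- Both sides sum over matchings with a marked unmatched vertex: it is one of `p`, and deleting it
-- leaves a matching of the other vertices and gives up one factor 2.
matchSum-lower : ∀ p f → matchSum p (λ m → m * f (pred m)) ≡ 2 * p * matchSum (pred p) f
matchSum-lower 0 f = refl
matchSum-lower 1 f = cong (2 *_) (+-identityʳ (f 0))
matchSum-lower (suc (suc p)) f = begin
  2 * matchSum (suc p) (λ m → suc m * f m) + 2 * suc p * matchSum p (λ m → m * f (pred m))
    ≡⟨ cong₂ (λ x y → 2 * x + 2 * suc p * y)
         (trans (matchSum-cong (suc p) (λ m → cong (f m +_) (sym (pred-irr m f)))) (matchSum-+ (suc p) f _))
         (matchSum-lower p f) ⟩
  2 * (matchSum (suc p) f + matchSum (suc p) (λ m → m * f (suc (pred m)))) + 2 * suc p * (2 * p * matchSum (pred p) f)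
    ≡⟨ cong (λ x → 2 * (matchSum (suc p) f + x) + 2 * suc p * (2 * p * matchSum (pred p) f)) (matchSum-lower (suc p) (f ∘ suc)) ⟩
  2 * (matchSum (suc p) f + 2 * suc p * matchSum p (f ∘ suc)) + 2 * suc p * (2 * p * matchSum (pred p) f)
    ≡⟨ lemma₁ (matchSum (suc p) f) (suc p) (matchSum p (f ∘ suc)) (2 * p * matchSum (pred p) f) ⟩
  2 * matchSum (suc p) f + 2 * suc p * (2 * matchSum p (f ∘ suc) + 2 * p * matchSum (pred p) f)
    ≡⟨ cong (λ x → 2 * matchSum (suc p) f + 2 * suc p * x) (sym (matchSum-suc p f)) ⟩
  2 * matchSum (suc p) f + 2 * suc p * matchSum (suc p) f
    ≡⟨ lemma₂ p (matchSum (suc p) f) ⟩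
  2 * suc (suc p) * matchSum (suc p) f ∎
  where
  open ≡-Reasoning
  lemma₁ : ∀ a b c d → 2 * (a + 2 * b * c) + 2 * b * d ≡ 2 * a + 2 * b * (2 * c + d)
  lemma₁ = solve-∀
  lemma₂ : ∀ p x → 2 * x + 2 * suc p * x ≡ 2 * suc (suc p) * x
  lemma₂ = solve-∀

-- The linear transform matchSum is triangular with nonzero diagonal.
matchSum-injective : ∀ {f h} → (∀ p → matchSum p f ≡ matchSum p h) → ∀ p → f p ≡ h p
matchSum-injective {f} {h} eq = <-rec (λ p → f p ≡ h p) (λ p ih → top p f h (λ m m<p → ih m<p) (eq p))
  where
  top : ∀ p f h → (∀ m → m < p → f m ≡ h m) → matchSum p f ≡ matchSum p h → f p ≡ h p
  top 0 f h _ e = e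
  top 1 f h _ e = *-cancelˡ-≡ (f 1) (h 1) 2 e
  top (suc (suc p)) f h below e = top (suc p) (f ∘ suc) (h ∘ suc) (λ m m< → below (suc m) (s≤s m<))
    (*-cancelˡ-≡ _ _ 2 (+-cancelʳ-≡ _ _ _
      (trans e (cong (λ x → 2 * matchSum (suc p) (h ∘ suc) + 2 * suc p * x)
        (sym (matchSum-cong-≤ p (λ m m≤p → below m (≤-trans (s≤s m≤p) (n≤1+n (suc p))))))))))

-- The binomial coefficient C(n,2), in a form where a new element adds its `n` pairs by computation.
tri : ℕ → ℕ
tri zero    = 0
tri (suc n) = n + tri n

tri-double : ∀ n → 2 * tri n ≡ n * pred n
tri-double zero = refl
tri-double (suc zero) = refl
tri-double (suc (suc n)) = trans (lemma₁ n (tri (suc n))) (trans (cong (2 * suc n +_) (tri-double (suc n))) (lemma₂ n))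
  where
  lemma₁ : ∀ n x → 2 * (suc n + x) ≡ 2 * suc n + 2 * x
  lemma₁ = solve-∀
  lemma₂ : ∀ n → 2 * suc n + suc n * n ≡ suc (suc n) * suc n
  lemma₂ = solve-∀

-- `c₀` and `c₁` stand for the counts with `p` and `p - 1` vertices of the first kind. The deleted
-- vertex has no neighbour, or one of the first kind, which moves to the second, or one of the
-- second kind, which is used up.
step₁ : (ℕ → ℕ) → (ℕ → ℕ) → ℕ → ℕ → ℕ
step₁ c₀ c₁ p q = c₀ q + p * c₁ (suc q) + q * c₀ (pred q)

step₂ : (ℕ → ℕ) → (ℕ → ℕ) → (ℕ → ℕ) → ℕ → ℕ → ℕ
step₂ c₀ c₁ c₂ p q = step₁ c₀ c₁ p q
  + (tri p * c₂ (suc (suc q)) + p * (q * c₁ q) + tri q * c₀ (pred (pred q)))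

-- The number of simple graphs on p vertices of degree at most 2 and q vertices of degree at most 1, see ∑graphs-pairs;
-- the summands of step₂ delete one of the p vertices according to the kinds of its neighbours.
γ : ℕ → ℕ → ℕ
γ 0 = τ
γ 1 = step₂ (γ 0) (γ 0) (γ 0) 0
γ 2 = step₂ (γ 1) (γ 0) (γ 0) 1
γ (suc (suc (suc p))) = step₂ (γ (suc (suc p))) (γ (suc p)) (γ p) (suc (suc p))

-- The clauses of `γ` repeat the lowest row where `pred` stops at 0; there the factor `p` or `tri p`
-- is 0.
γ-suc : ∀ p q → γ (suc p) q ≡ step₂ (γ p) (γ (pred p)) (γ (pred (pred p))) p q
γ-suc 0 q = refl
γ-suc 1 q = refl
γ-suc (suc (suc p)) q = refl


-- The transform of `γ` and the two recurrences

*τ : ∀ n → n * τ n ≡ n * τ (pred n) + n * pred n * τ (pred (pred n))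
*τ zero    = refl
*τ (suc n) rewrite τ-suc n = lemma (suc n) n (τ n) (τ (pred n))
  where
  lemma : ∀ m n a b → m * (a + n * b) ≡ m * a + m * n * b
  lemma = solve-∀

-- Two new points are both fixed or exchanged with each other, or exactly one is paired with an old
-- point, or both are. A new vertex of the first kind is such a pair of points.
τ-suc-suc : ∀ n → τ (suc (suc n)) ≡ 2 * τ n + 2 * n * τ (pred n) + n * pred n * τ (pred (pred n))
τ-suc-suc n = begin
  τ (suc n) + (τ n + n * τ n)
    ≡⟨ cong₂ (λ x y → x + (τ n + y)) (τ-suc n) (*τ n) ⟩
  (τ n + n * τ (pred n)) + (τ n + (n * τ (pred n) + n * pred n * τ (pred (pred n))))
    ≡⟨ lemma (τ n) n (τ (pred n)) (n * pred n * τ (pred (pred n))) ⟩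
  2 * τ n + 2 * n * τ (pred n) + n * pred n * τ (pred (pred n)) ∎
  where
  open ≡-Reasoning
  lemma : ∀ a n b c → (a + n * b) + (a + (n * b + c)) ≡ 2 * a + 2 * n * b + c
  lemma = solve-∀

-- The index shifts below hold only under the displayed factors, since pred 0 = 0.
*τ-p : ∀ p q → p * τ (2 * pred p + suc q) ≡ p * τ (pred (2 * p + q))
*τ-p zero    q = refl
*τ-p (suc p) q = cong (λ n → suc p * τ n) (lemma p q)
  where
  lemma : ∀ p q → 2 * p + suc q ≡ p + (suc p + 0) + q
  lemma = solve-∀

*τ-q : ∀ p q → q * τ (2 * p + pred q) ≡ q * τ (pred (2 * p + q))
*τ-q p zero    = refl
*τ-q p (suc q) = cong (λ n → suc q * τ (pred n)) (sym (+-suc (2 * p) q))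

*τ-pp : ∀ p q → p * pred p * τ (2 * pred (pred p) + suc (suc q)) ≡ p * pred p * τ (pred (pred (2 * p + q)))
*τ-pp 0 q = refl
*τ-pp 1 q = refl
*τ-pp (suc (suc p)) q = cong (λ n → suc (suc p) * suc p * τ (pred n)) (lemma p q)
  where
  lemma : ∀ p q → suc (2 * p + suc (suc q)) ≡ suc p + (suc (suc p) + 0) + q
  lemma = solve-∀

*τ-p₁ : ∀ p q → p * τ (2 * pred p + q) ≡ p * τ (pred (pred (2 * p + q)))
*τ-p₁ zero    q = refl
*τ-p₁ (suc p) q = cong (λ n → suc p * τ (pred n)) (lemma p q)
  where
  lemma : ∀ p q → suc (2 * p + q) ≡ p + (suc p + 0) + q
  lemma = solve-∀

*τ-qq : ∀ p q → q * pred q * τ (2 * p + pred (pred q)) ≡ q * pred q * τ (pred (pred (2 * p + q)))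
*τ-qq p 0 = refl
*τ-qq p 1 = refl
*τ-qq p (suc (suc q)) = cong (λ n → suc (suc q) * suc q * τ (pred (pred n)))
  (sym (trans (+-suc (2 * p) (suc q)) (cong suc (+-suc (2 * p) q))))

*-pred : ∀ n → n * pred n + n ≡ n * n
*-pred zero    = refl
*-pred (suc n) = lemma n
  where
  lemma : ∀ n → suc n * n + suc n ≡ suc n * suc n
  lemma = solve-∀

-- Ordered pairs of distinct points among `p` pairs and `q` singletons: from two pairs, from a pair
-- and a singleton, from two singletons, from one pair.
*-pred-2p+q : ∀ p q → 4 * (p * pred p) + 4 * (p * q) + q * pred q + 2 * p ≡ (2 * p + q) * pred (2 * p + q)
*-pred-2p+q p q = +-cancelʳ-≡ (2 * p + q) _ _ (begin
  4 * (p * pred p) + 4 * (p * q) + q * pred q + 2 * p + (2 * p + q)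
    ≡⟨ lemma₁ p q (p * pred p) (q * pred q) ⟩
  4 * (p * pred p + p) + 4 * (p * q) + (q * pred q + q)
    ≡⟨ cong₂ (λ x y → 4 * x + 4 * (p * q) + y) (*-pred p) (*-pred q) ⟩
  4 * (p * p) + 4 * (p * q) + q * q
    ≡⟨ lemma₂ p q ⟩
  (2 * p + q) * (2 * p + q)
    ≡⟨ sym (*-pred (2 * p + q)) ⟩
  (2 * p + q) * pred (2 * p + q) + (2 * p + q) ∎)
  where
  open ≡-Reasoning
  lemma₁ : ∀ p q x y → 4 * x + 4 * (p * q) + y + 2 * p + (2 * p + q) ≡ 4 * (x + p) + 4 * (p * q) + (y + q)
  lemma₁ = solve-∀
  lemma₂ : ∀ p q → 4 * (p * p) + 4 * (p * q) + q * q ≡ (2 * p + q) * (2 * p + q)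
  lemma₂ = solve-∀

matchSum-step₁ : ∀ p q (c : ℕ → ℕ → ℕ) →
  matchSum p (λ m → step₁ (c m) (c (pred m)) m q) ≡
  matchSum p (λ m → c m q) + 2 * p * matchSum (pred p) (λ m → c m (suc q)) + q * matchSum p (λ m → c m (pred q))
matchSum-step₁ p q c = trans (matchSum-+ p _ _) (cong₂ _+_
  (trans (matchSum-+ p _ _) (cong (matchSum p (λ m → c m q) +_) (matchSum-lower p (λ m → c m (suc q)))))
  (matchSum-* p q (λ m → c m (pred q))))

matchSum-lower² : ∀ p f → matchSum p (λ m → 2 * (tri m * f (pred (pred m)))) ≡ 4 * (p * pred p) * matchSum (pred (pred p)) f
matchSum-lower² p f = begin
  matchSum p (λ m → 2 * (tri m * f (pred (pred m))))
    ≡⟨ matchSum-cong p (λ m → trans (sym (*-assoc 2 (tri m) _)) (trans (cong (_* f (pred (pred m))) (tri-double m)) (*-assoc m (pred m) _))) ⟩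
  matchSum p (λ m → m * (pred m * f (pred (pred m))))
    ≡⟨ matchSum-lower p (λ m → m * f (pred m)) ⟩
  2 * p * matchSum (pred p) (λ m → m * f (pred m))
    ≡⟨ cong (2 * p *_) (matchSum-lower (pred p) f) ⟩
  2 * p * (2 * pred p * matchSum (pred (pred p)) f)
    ≡⟨ lemma p (pred p) (matchSum (pred (pred p)) f) ⟩
  4 * (p * pred p) * matchSum (pred (pred p)) f ∎
  where
  open ≡-Reasoning
  lemma : ∀ p r x → 2 * p * (2 * r * x) ≡ 4 * (p * r) * x
  lemma = solve-∀

-- In the last summand the new vertex is matched, that is, lies on a double edge; the others leave
-- it unmatched and expand `γ (suc m)` by its neighbours. The factor 2 of an unmatched vertex turns
-- `tri` into a product.
matchSum-γ-suc : ∀ p q →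
  matchSum (suc p) (λ m → γ m q) ≡
    2 * (matchSum p (λ m → γ m q) + 2 * p * matchSum (pred p) (λ m → γ m (suc q)) + q * matchSum p (λ m → γ m (pred q)))
  + (4 * (p * pred p) * matchSum (pred (pred p)) (λ m → γ m (suc (suc q)))
    + 4 * (p * q) * matchSum (pred p) (λ m → γ m q)
    + q * pred q * matchSum p (λ m → γ m (pred (pred q))))
  + 2 * p * matchSum (pred p) (λ m → γ m q)
matchSum-γ-suc p q = trans (matchSum-suc p _) (cong (_+ 2 * p * matchSum (pred p) (λ m → γ m q)) (begin
  2 * matchSum p (λ m → γ (suc m) q)
    ≡⟨ cong (2 *_) (trans (matchSum-cong p (λ m → γ-suc m q)) (matchSum-+ p _ _)) ⟩
  2 * (matchSum p (λ m → step₁ (γ m) (γ (pred m)) m q) + matchSum p (λ m → rest m))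
    ≡⟨ *-distribˡ-+ 2 (matchSum p (λ m → step₁ (γ m) (γ (pred m)) m q)) (matchSum p rest) ⟩
  2 * matchSum p (λ m → step₁ (γ m) (γ (pred m)) m q) + 2 * matchSum p rest
    ≡⟨ cong₂ _+_ (cong (2 *_) (matchSum-step₁ p q γ)) rest-sum ⟩
  _ ∎))
  where
  open ≡-Reasoning
  rest : ℕ → ℕ
  rest m = tri m * γ (pred (pred m)) (suc (suc q)) + m * (q * γ (pred m) q) + tri q * γ m (pred (pred q))

  rest-sum : 2 * matchSum p rest ≡ 4 * (p * pred p) * matchSum (pred (pred p)) (λ m → γ m (suc (suc q)))
    + 4 * (p * q) * matchSum (pred p) (λ m → γ m q)
    + q * pred q * matchSum p (λ m → γ m (pred (pred q)))
  rest-sum = begin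
    2 * matchSum p rest
      ≡⟨ cong (2 *_) (trans (matchSum-+ p _ _) (cong (_+ matchSum p (λ m → tri q * γ m (pred (pred q)))) (matchSum-+ p _ _))) ⟩
    2 * (matchSum p (λ m → tri m * γ (pred (pred m)) (suc (suc q))) + matchSum p (λ m → m * (q * γ (pred m) q)) + matchSum p (λ m → tri q * γ m (pred (pred q))))
      ≡⟨ cong₂ (λ x y → 2 * (matchSum p (λ m → tri m * γ (pred (pred m)) (suc (suc q))) + x + y))
           (trans (matchSum-lower p (λ m → q * γ m q)) (cong (2 * p *_) (matchSum-* (pred p) q _))) (matchSum-* p (tri q) _) ⟩
    2 * (matchSum p (λ m → tri m * γ (pred (pred m)) (suc (suc q))) + 2 * p * (q * matchSum (pred p) (λ m → γ m q)) + tri q * matchSum p (λ m → γ m (pred (pred q))))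
      ≡⟨ lemma (matchSum p (λ m → tri m * γ (pred (pred m)) (suc (suc q)))) p q (matchSum (pred p) (λ m → γ m q)) (tri q) _ ⟩
    2 * matchSum p (λ m → tri m * γ (pred (pred m)) (suc (suc q))) + 4 * (p * q) * matchSum (pred p) (λ m → γ m q) + 2 * tri q * matchSum p (λ m → γ m (pred (pred q)))
      ≡⟨ cong₂ (λ x y → x + 4 * (p * q) * matchSum (pred p) (λ m → γ m q) + y * matchSum p (λ m → γ m (pred (pred q))))
           (trans (sym (matchSum-* p 2 _)) (matchSum-lower² p (λ m → γ m (suc (suc q))))) (tri-double q) ⟩
    _ ∎
    where
    lemma : ∀ x p q y c z → 2 * (x + 2 * p * (q * y) + c * z) ≡ 2 * x + 4 * (p * q) * y + 2 * c * z
    lemma = solve-∀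

-- Strong induction on `p` with `q` free, because a neighbour of the first kind raises `q`.
-- Collecting terms gives `τ-suc-suc`; the double edges supply the cases where both new points are
-- paired with the two points of one pair.
matchSum-γ : ∀ p q → matchSum p (λ m → γ m q) ≡ τ (2 * p + q)
matchSum-γ = <-rec (λ p → ∀ q → matchSum p (λ m → γ m q) ≡ τ (2 * p + q)) step
  where
  open ≡-Reasoning
  step : ∀ p → (∀ {p′} → p′ < p → ∀ q → matchSum p′ (λ m → γ m q) ≡ τ (2 * p′ + q)) → ∀ q → matchSum p (λ m → γ m q) ≡ τ (2 * p + q)
  step zero    ih q = refl
  step (suc p) ih q
    rewrite matchSum-γ-suc p q
          | ih (n<1+n p) q | ih (s≤s (pred[n]≤n {p})) (suc q) | ih (n<1+n p) (pred q)
          | ih (s≤s (≤-trans (pred[n]≤n {pred p}) (pred[n]≤n {p}))) (suc (suc q))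
          | ih (s≤s (pred[n]≤n {p})) q | ih (n<1+n p) (pred (pred q)) = begin
    2 * (τ n + 2 * p * τ (2 * pred p + suc q) + q * τ (2 * p + pred q))
      + (4 * (p * pred p) * τ (2 * pred (pred p) + suc (suc q)) + 4 * (p * q) * τ (2 * pred p + q)
        + q * pred q * τ (2 * p + pred (pred q)))
      + 2 * p * τ (2 * pred p + q)
      ≡⟨ lemma₁ (τ n) p q _ _ (p * pred p) _ _ _ ⟩
    2 * τ n + 4 * (p * τ (2 * pred p + suc q)) + 2 * (q * τ (2 * p + pred q))
      + (4 * (p * pred p * τ (2 * pred (pred p) + suc (suc q))) + 4 * q * (p * τ (2 * pred p + q))
        + q * pred q * τ (2 * p + pred (pred q)))
      + 2 * (p * τ (2 * pred p + q))
      ≡⟨ cong₂ _+_ (cong₂ _+_ (cong₂ (λ x y → 2 * τ n + 4 * x + 2 * y) (*τ-p p q) (*τ-q p q))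
           (cong₂ _+_ (cong₂ (λ x y → 4 * x + 4 * q * y) (*τ-pp p q) (*τ-p₁ p q)) (*τ-qq p q)))
           (cong (2 *_) (*τ-p₁ p q)) ⟩
    2 * τ n + 4 * (p * a) + 2 * (q * a)
      + (4 * (p * pred p * b) + 4 * q * (p * b) + q * pred q * b) + 2 * (p * b)
      ≡⟨ lemma₂ (τ n) p q a (p * pred p) (q * pred q) b ⟩
    2 * τ n + 2 * n * a + (4 * (p * pred p) + 4 * (p * q) + q * pred q + 2 * p) * b
      ≡⟨ cong (λ x → 2 * τ n + 2 * n * a + x * b) (*-pred-2p+q p q) ⟩
    2 * τ n + 2 * n * a + n * pred n * b
      ≡⟨ sym (τ-suc-suc n) ⟩
    τ (suc (suc n))
      ≡⟨ cong τ (lemma₃ p q) ⟩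
    τ (2 * suc p + q) ∎
    where
    n = 2 * p + q
    a = τ (pred n)
    b = τ (pred (pred n))
    lemma₁ : ∀ t p q x y pp z w v →
      2 * (t + 2 * p * x + q * y) + (4 * pp * z + 4 * (p * q) * w + v) + 2 * p * w ≡
      2 * t + 4 * (p * x) + 2 * (q * y) + (4 * (pp * z) + 4 * q * (p * w) + v) + 2 * (p * w)
    lemma₁ = solve-∀
    lemma₂ : ∀ t p q a pp qq b →
      2 * t + 4 * (p * a) + 2 * (q * a) + (4 * (pp * b) + 4 * q * (p * b) + qq * b) + 2 * (p * b) ≡
      2 * t + 2 * (2 * p + q) * a + (4 * pp + 4 * (p * q) + qq + 2 * p) * b
    lemma₂ = solve-∀
    lemma₃ : ∀ p q → suc (suc (2 * p + q)) ≡ 2 * suc p + q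
    lemma₃ = solve-∀

-- Both sides have the same image under matchSum.
γ-step₁ : ∀ p q → γ p (suc q) ≡ step₁ (γ p) (γ (pred p)) p q
γ-step₁ p q = matchSum-injective {λ m → γ m (suc q)} {λ m → step₁ (γ m) (γ (pred m)) m q} (λ n → begin
  matchSum n (λ m → γ m (suc q))
    ≡⟨ matchSum-γ n (suc q) ⟩
  τ (2 * n + suc q)
    ≡⟨ cong τ (+-suc (2 * n) q) ⟩
  τ (suc (2 * n + q))
    ≡⟨ trans (τ-suc (2 * n + q)) (lemma (τ (2 * n + q)) n q _) ⟩
  τ (2 * n + q) + 2 * (n * τ (pred (2 * n + q))) + q * τ (pred (2 * n + q))
    ≡⟨ cong₂ (λ x y → τ (2 * n + q) + 2 * x + y) (sym (*τ-p n q)) (sym (*τ-q n q)) ⟩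
  τ (2 * n + q) + 2 * (n * τ (2 * pred n + suc q)) + q * τ (2 * n + pred q)
    ≡⟨ cong (λ x → τ (2 * n + q) + x + q * τ (2 * n + pred q)) (sym (*-assoc 2 n _)) ⟩
  τ (2 * n + q) + 2 * n * τ (2 * pred n + suc q) + q * τ (2 * n + pred q)
    ≡⟨ sym (cong₂ _+_ (cong₂ (λ x y → x + 2 * n * y) (matchSum-γ n q) (matchSum-γ (pred n) (suc q))) (cong (q *_) (matchSum-γ n (pred q)))) ⟩
  matchSum n (λ m → γ m q) + 2 * n * matchSum (pred n) (λ m → γ m (suc q)) + q * matchSum n (λ m → γ m (pred q))
    ≡⟨ sym (matchSum-step₁ n q γ) ⟩
  matchSum n (λ m → step₁ (γ m) (γ (pred m)) m q) ∎) p
  where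
  open ≡-Reasoning
  lemma : ∀ t n q x → t + (2 * n + q) * x ≡ t + 2 * (n * x) + q * x
  lemma = solve-∀

-- The recurrence of the involution numbers

private variable
  X Y : Set
  m n N : ℕ

lookup-ext : {xs ys : Vec X n} → (∀ i → lookup xs i ≡ lookup ys i) → xs ≡ ys
lookup-ext {xs = xs} {ys} eq =
  trans (sym (Vec.tabulate∘lookup xs)) (trans (Vec.tabulate-cong eq) (Vec.tabulate∘lookup ys))

vecs-suc : (xs : List X) → ∀ m → vecs xs (suc m) ≡ cartesianProductWith _∷_ xs (vecs xs m)
vecs-suc {X} xs m = go xs
  where
  go : ∀ zs → concatMap (λ x → map (x ∷_) (vecs xs m)) zs ≡ cartesianProductWith _∷_ zs (vecs xs m)
  go []       = refl
  go (z ∷ zs) = cong (map (z ∷_) (vecs xs m) ++_) (go zs)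

vecs-unique : {xs : List X} → Unique xs → ∀ m → Unique (vecs xs m)
vecs-unique u zero = [] ∷ []
vecs-unique {xs = xs} u (suc m) rewrite vecs-suc xs m =
  Unique.cartesianProductWith⁺ _∷_ Vec.∷-injective u (vecs-unique u m)

∈-vecs-allFin : (v : Vec (Fin n) m) → v ∈ vecs (allFin n) m
∈-vecs-allFin [] = here refl
∈-vecs-allFin {n} {suc m} (x ∷ v) rewrite vecs-suc (allFin n) m =
  ∈-cartesianProductWith⁺ _∷_ (∈-allFin x) (∈-vecs-allFin v)

involutions-unique : ∀ n → Unique (involutions n)
involutions-unique n = Unique.filter⁺ _ (vecs-unique (Unique.allFin⁺ n) n)

∈-involutions⁺ : {v : Vec (Fin n) n} → IsInvolution v → v ∈ involutions n
∈-involutions⁺ {v = v} inv = ∈-filter⁺ _ (∈-vecs-allFin v) inv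

∈-involutions⁻ : {v : Vec (Fin n) n} → v ∈ involutions n → IsInvolution v
∈-involutions⁻ {n} v∈ = proj₂ (∈-filter⁻ _ {xs = vecs (allFin n) n} v∈)

fixZero : Vec (Fin n) n → Vec (Fin (suc n)) (suc n)
fixZero h = zero ∷ Vec.map suc h

-- `punchIn j` numbers the points other than the partner of `zero`; the inserted entry sends this
-- partner back.
swapZero : Fin (suc n) → Vec (Fin n) n → Vec (Fin (suc (suc n))) (suc (suc n))
swapZero j h = suc j ∷ insertAt (Vec.map (suc ∘ punchIn j) h) j zero

module _ {n} (h : Vec (Fin n) n) where

  lookup-fixZero : ∀ i → lookup (fixZero h) (suc i) ≡ suc (lookup h i)
  lookup-fixZero i = Vec.lookup-map i suc h

  fixZero⁺ : IsInvolution h → IsInvolution (fixZero h)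
  fixZero⁺ inv zero    = refl
  fixZero⁺ inv (suc i) = trans (cong (lookup (fixZero h)) (lookup-fixZero i))
    (trans (lookup-fixZero (lookup h i)) (cong suc (inv i)))

  fixZero⁻ : IsInvolution (fixZero h) → IsInvolution h
  fixZero⁻ inv i = Fin.suc-injective (trans (sym (trans (cong (lookup (fixZero h)) (lookup-fixZero i))
    (lookup-fixZero (lookup h i)))) (inv (suc i)))

  module _ (j : Fin (suc n)) where

    lookup-swapZero : lookup (swapZero j h) (suc j) ≡ zero
    lookup-swapZero = Vec.insertAt-lookup _ j zero

    lookup-swapZero-punchIn : ∀ i → lookup (swapZero j h) (suc (punchIn j i)) ≡ suc (punchIn j (lookup h i))
    lookup-swapZero-punchIn i = trans (Vec.insertAt-punchIn _ j zero i) (Vec.lookup-map i _ h)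

    lookup-swapZero² : ∀ i → lookup (swapZero j h) (lookup (swapZero j h) (suc (punchIn j i))) ≡ suc (punchIn j (lookup h (lookup h i)))
    lookup-swapZero² i = trans (cong (lookup (swapZero j h)) (lookup-swapZero-punchIn i)) (lookup-swapZero-punchIn (lookup h i))

    swapZero⁺ : IsInvolution h → IsInvolution (swapZero j h)
    swapZero⁺ inv zero = lookup-swapZero
    swapZero⁺ inv (suc i) with j Fin.≟ i
    ... | yes refl = cong (lookup (swapZero j h)) lookup-swapZero
    ... | no j≢i = subst (λ i → lookup (swapZero j h) (lookup (swapZero j h) (suc i)) ≡ suc i) (Fin.punchIn-punchOut j≢i)
                     (trans (lookup-swapZero² (punchOut j≢i)) (cong (suc ∘ punchIn j) (inv (punchOut j≢i))))

    swapZero⁻ : IsInvolution (swapZero j h) → IsInvolution h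
    swapZero⁻ inv i = Fin.punchIn-injective j _ _
      (Fin.suc-injective (trans (sym (lookup-swapZero² i)) (inv (suc (punchIn j i)))))

map-injective : {Y : Set} {f : X → Y} → (∀ {x y} → f x ≡ f y → x ≡ y) → {xs ys : Vec X n} → Vec.map f xs ≡ Vec.map f ys → xs ≡ ys
map-injective {f = f} f-inj {xs} {ys} eq = lookup-ext (λ i →
  f-inj (trans (sym (Vec.lookup-map i f xs)) (trans (cong (λ v → lookup v i) eq) (Vec.lookup-map i f ys))))

fixZero-injective : {h h′ : Vec (Fin n) n} → fixZero h ≡ fixZero h′ → h ≡ h′
fixZero-injective eq = map-injective Fin.suc-injective (Vec.∷-injectiveʳ eq)

swapZero-injective : ∀ {j j′ : Fin (suc n)} {h h′} → swapZero j h ≡ swapZero j′ h′ → j ≡ j′ × h ≡ h′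
swapZero-injective {j = j} {h = h} {h′} eq with refl ← Vec.∷-injectiveˡ eq = refl , lookup-ext (λ i →
  Fin.punchIn-injective j _ _ (Fin.suc-injective
    (trans (sym (lookup-swapZero-punchIn h j i)) (trans (cong (λ v → lookup v (suc (punchIn j i))) eq) (lookup-swapZero-punchIn h′ j i)))))

IsInvolution⇒fixZero : (v : Vec (Fin (suc n)) (suc n)) → IsInvolution v → lookup v zero ≡ zero → ∃ λ h → v ≡ fixZero h
IsInvolution⇒fixZero {n} v inv v0 = h , lookup-ext eq
  where
  image : ∀ i → Σ (Fin n) λ l → lookup v (suc i) ≡ suc l
  image i with lookup v (suc i) in vi
  ... | zero  with () ← trans (sym v0) (trans (cong (lookup v) (sym vi)) (inv (suc i)))
  ... | suc l = l , refl

  h : Vec (Fin n) n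
  h = tabulate (proj₁ ∘ image)

  eq : ∀ i → lookup v i ≡ lookup (fixZero h) i
  eq zero    = v0
  eq (suc i) = trans (proj₂ (image i)) (sym (trans (lookup-fixZero h i) (cong suc (Vec.lookup∘tabulate (proj₁ ∘ image) i))))

-- `zero` and `suc j` are exchanged, and an involution is injective, so every other point has its
-- image outside these two, where `punchIn j` reaches it.
IsInvolution⇒swapZero : (v : Vec (Fin (suc (suc n))) (suc (suc n))) → IsInvolution v →
  ∀ j → lookup v zero ≡ suc j → ∃ λ h → v ≡ swapZero j h
IsInvolution⇒swapZero {n} v inv j v0 = h , lookup-ext eq
  where
  vj : lookup v (suc j) ≡ zero
  vj = trans (cong (lookup v) (sym v0)) (inv zero)

  image : ∀ i → Σ (Fin n) λ l → lookup v (suc (punchIn j i)) ≡ suc (punchIn j l)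
  image i with lookup v (suc (punchIn j i)) in vi
  ... | zero  = ⊥-elim (Fin.punchInᵢ≢i j i (Fin.suc-injective
                  (trans (sym (inv (suc (punchIn j i)))) (trans (cong (lookup v) vi) v0))))
  ... | suc y with j Fin.≟ y
  ...   | no j≢y = punchOut j≢y , cong suc (sym (Fin.punchIn-punchOut j≢y))
  ...   | yes refl with () ← trans (sym vj) (trans (cong (lookup v) (sym vi)) (inv (suc (punchIn j i))))

  h : Vec (Fin n) n
  h = tabulate (proj₁ ∘ image)

  eq : ∀ i → lookup v i ≡ lookup (swapZero j h) i
  eq zero = v0
  eq (suc i) with j Fin.≟ i
  ... | yes refl = trans vj (sym (lookup-swapZero h j))
  ... | no j≢i   = subst (λ i → lookup v (suc i) ≡ lookup (swapZero j h) (suc i)) (Fin.punchIn-punchOut j≢i)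
    (trans (proj₂ (image (punchOut j≢i))) (sym (trans (lookup-swapZero-punchIn h j (punchOut j≢i)) (cong (suc ∘ punchIn j) (Vec.lookup∘tabulate (proj₁ ∘ image) (punchOut j≢i))))))

-- Duplicate-free lists with the same members have equal length, so the order of enumeration is
-- irrelevant. The image of `zero` decides which list contains an involution.
t-suc-suc : ∀ n → t (suc (suc n)) ≡ t (suc n) + suc n * t n
t-suc-suc n = begin
  length (involutions (suc (suc n)))
    ≡⟨ ↭-length (∼bag⇒↭ (unique∧set⇒bag (involutions-unique _) split-unique (mk⇔ to from))) ⟩
  length (fixed ++ swapped)
    ≡⟨ List.length-++ fixed ⟩
  length fixed + length swapped
    ≡⟨ cong₂ _+_ (List.length-map fixZero (involutions (suc n)))
         (trans (length-cartesianProductWith (allFin (suc n)) (involutions n)) (cong (_* t n) (List.length-tabulate {n = suc n} (λ i → i)))) ⟩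
  t (suc n) + suc n * t n ∎
  where
  open ≡-Reasoning
  fixed swapped : List (Vec (Fin (suc (suc n))) (suc (suc n)))
  fixed   = map fixZero (involutions (suc n))
  swapped = cartesianProductWith swapZero (allFin (suc n)) (involutions n)

  length-cartesianProductWith : ∀ xs ys → length (cartesianProductWith (swapZero {n}) xs ys) ≡ length xs * length ys
  length-cartesianProductWith []       ys = refl
  length-cartesianProductWith (x ∷ xs) ys = trans (List.length-++ (map (swapZero x) ys))
    (cong₂ _+_ (List.length-map (swapZero x) ys) (length-cartesianProductWith xs ys))

  disjoint : ∀ {v} → v ∈ fixed × v ∈ swapped → ⊥
  disjoint (v∈ , v∈′)
    with _ , _ , refl ← ∈-map⁻ fixZero v∈
       | _ , _ , _ , _ , () ← ∈-cartesianProductWith⁻ swapZero (allFin (suc n)) (involutions n) v∈′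

  split-unique : Unique (fixed ++ swapped)
  split-unique = Unique.++⁺ (Unique.map⁺ fixZero-injective (involutions-unique (suc n)))
    (Unique.cartesianProductWith⁺ swapZero swapZero-injective (Unique.allFin⁺ (suc n)) (involutions-unique n))
    disjoint

  to : ∀ {v} → v ∈ involutions (suc (suc n)) → v ∈ fixed ++ swapped
  to {v} v∈ with lookup v zero in v0
  ... | zero with h , refl ← IsInvolution⇒fixZero v (∈-involutions⁻ v∈) v0 =
    ∈-++⁺ˡ (∈-map⁺ fixZero (∈-involutions⁺ (fixZero⁻ h (∈-involutions⁻ v∈))))
  ... | suc j with h , refl ← IsInvolution⇒swapZero v (∈-involutions⁻ v∈) j v0 =
    ∈-++⁺ʳ fixed (∈-cartesianProductWith⁺ swapZero (∈-allFin j) (∈-involutions⁺ (swapZero⁻ h j (∈-involutions⁻ v∈))))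

  from : ∀ {v} → v ∈ fixed ++ swapped → v ∈ involutions (suc (suc n))
  from v∈ with ∈-++⁻ fixed v∈
  ... | inj₁ v∈₁ with h , h∈ , refl ← ∈-map⁻ fixZero v∈₁ = ∈-involutions⁺ (fixZero⁺ h (∈-involutions⁻ h∈))
  ... | inj₂ v∈₂ with j , h , _ , h∈ , refl ← ∈-cartesianProductWith⁻ swapZero (allFin (suc n)) (involutions n) v∈₂ =
    ∈-involutions⁺ (swapZero⁺ h j (∈-involutions⁻ h∈))

t≡τ : ∀ n → t n ≡ τ n
t≡τ 0 = refl
t≡τ 1 = refl
t≡τ (suc (suc n)) = trans (t-suc-suc n) (cong₂ (λ x y → x + suc n * y) (t≡τ (suc n)) (t≡τ n))

-- Simple graphs with bounded degrees

T-ext : ∀ {x y} → (T x → T y) → (T y → T x) → x ≡ y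
T-ext {false} {false} _ _ = refl
T-ext {false} {true}  _ g = ⊥-elim (g tt)
T-ext {true}  {false} f _ = ⊥-elim (f tt)
T-ext {true}  {true}  _ _ = refl

all-allFin⁺ : (f : Fin N → Bool) → (∀ v → T (f v)) → T (all f (allFin N))
all-allFin⁺ f h = ListAll.all⁻ f (ListAll.tabulate⁺ h)

all-allFin⁻ : (f : Fin N → Bool) → T (all f (allFin N)) → ∀ v → T (f v)
all-allFin⁻ f h v = ListAll.lookup (ListAll.all⁺ f (allFin _) h) (∈-allFin v)

all-allFin-cong : {f h : Fin N → Bool} → (∀ v → f v ≡ h v) → all f (allFin N) ≡ all h (allFin N)
all-allFin-cong {f = f} {h} eq = T-ext
  (λ t → all-allFin⁺ h (λ v → subst T (eq v) (all-allFin⁻ f t v)))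
  (λ t → all-allFin⁺ f (λ v → subst T (sym (eq v)) (all-allFin⁻ h t v)))

count : (X → Bool) → List X → ℕ
count P xs = length (filterᵇ P xs)

count-cong : {P Q : X → Bool} → (∀ x → P x ≡ Q x) → ∀ xs → count P xs ≡ count Q xs
count-cong eq [] = refl
count-cong {P = P} {Q} eq (x ∷ xs) with P x | Q x | eq x
... | true  | _ | refl = cong suc (count-cong eq xs)
... | false | _ | refl = count-cong eq xs

count-++ : (P : X → Bool) → ∀ xs ys → count P (xs ++ ys) ≡ count P xs + count P ys
count-++ P [] ys = refl
count-++ P (x ∷ xs) ys with P x
... | true  = cong suc (count-++ P xs ys)
... | false = count-++ P xs ys

count-map : (P : Y → Bool) (f : X → Y) → ∀ xs → count P (map f xs) ≡ count (P ∘ f) xs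
count-map P f [] = refl
count-map P f (x ∷ xs) with P (f x)
... | true  = cong suc (count-map P f xs)
... | false = count-map P f xs

count-false : ∀ (xs : List X) → count (const false) xs ≡ 0
count-false []       = refl
count-false (x ∷ xs) = count-false xs

count-∧ˡ : ∀ c (P : X → Bool) xs → count (λ x → c ∧ P x) xs ≡ (if c then count P xs else 0)
count-∧ˡ true  P xs = refl
count-∧ˡ false P xs = count-false xs

count-filterᵇ : (P Q : X → Bool) → ∀ xs → count Q (filterᵇ P xs) ≡ count (λ x → P x ∧ Q x) xs
count-filterᵇ P Q [] = refl
count-filterᵇ P Q (x ∷ xs) with P x
... | false = count-filterᵇ P Q xs
... | true with Q x
...   | true  = cong suc (count-filterᵇ P Q xs)
...   | false = count-filterᵇ P Q xs

-- Counting graphs edge by edge under degree bounds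

Edge : ℕ → Set
Edge N = Fin N × Fin N

incident : Edge N → Fin N → Bool
incident e v = (toℕ (proj₁ e) ≡ᵇ toℕ v) ∨ (toℕ (proj₂ e) ≡ᵇ toℕ v)

-- An arbitrary list of edges allows induction on it; at `pairs (numV m)` this computes to
-- `degree m`.
deg : (ps : List (Edge N)) → Vec (Fin 3) (length ps) → Fin N → ℕ
deg ps G v = sum (map (λ e → if incident (proj₁ e) v then proj₂ e else 0) (zip ps (map toℕ (toList G))))

fits : Vec ℕ N → (ps : List (Edge N)) → Vec (Fin 3) (length ps) → Bool
fits {N} b ps G = all (λ v → deg ps G v ≤ᵇ lookup b v) (allFin N)

simple : ∀ {n} → Vec (Fin 3) n → Bool
simple G = all (λ x → not (toℕ x ≡ᵇ 2)) (toList G)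

available : Edge N → Vec ℕ N → Bool
available (u , w) b = (1 ≤ᵇ lookup b u) ∧ (1 ≤ᵇ lookup b w)

use : Edge N → Vec ℕ N → Vec ℕ N
use e b = tabulate (λ v → if incident e v then pred (lookup b v) else lookup b v)

-- Sums κ of the residual degree bounds over all sets of edges from ps that respect the bounds b.
∑graphs : List (Edge N) → Vec ℕ N → (Vec ℕ N → ℕ) → ℕ
∑graphs []       b κ = κ b
∑graphs (e ∷ ps) b κ = ∑graphs ps b κ + (if available e b then ∑graphs ps (use e b) κ else 0)

incident-proj₁ : ∀ (u w : Fin N) → incident (u , w) u ≡ true
incident-proj₁ u w rewrite T-ext {toℕ u ≡ᵇ toℕ u} {true} (λ _ → tt) (λ _ → ≡⇒≡ᵇ (toℕ u) (toℕ u) refl) = refl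

incident-proj₂ : ∀ (u w : Fin N) → incident (u , w) w ≡ true
incident-proj₂ u w rewrite T-ext {toℕ w ≡ᵇ toℕ w} {true} (λ _ → tt) (λ _ → ≡⇒≡ᵇ (toℕ w) (toℕ w) refl) = Bool.∨-zeroʳ _

-- The edge uses one unit of the bound at each end. `available` rules out a saturated end, where
-- `pred 0 = 0` would give the edge away for free.
fits-1∷ : ∀ (b : Vec ℕ N) e ps G → fits b (e ∷ ps) (suc zero ∷ G) ≡ available e b ∧ fits (use e b) ps G
fits-1∷ {N} b e@(u , w) ps G = T-ext
  (λ h → let below v = ≤ᵇ⇒≤ _ _ (all-allFin⁻ (λ v → deg (e ∷ ps) (suc zero ∷ G) v ≤ᵇ lookup b v) h v) in
    Equivalence.from Bool.T-∧
      ( Equivalence.from Bool.T-∧ (positive u (incident-proj₁ u w) (below u) , positive w (incident-proj₂ u w) (below w))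
      , all-allFin⁺ (λ v → deg ps G v ≤ᵇ lookup (use e b) v) (λ v → ≤⇒≤ᵇ (subst (deg ps G v ≤_) (sym (lookup-use v)) (lower v (below v))))))
  (λ h → let av , ft = Equivalence.to (Bool.T-∧ {available e b}) h
             au , aw = Equivalence.to (Bool.T-∧ {1 ≤ᵇ lookup b u}) av
             below v = ≤ᵇ⇒≤ _ _ (all-allFin⁻ (λ v → deg ps G v ≤ᵇ lookup (use e b) v) ft v) in
    all-allFin⁺ (λ v → deg (e ∷ ps) (suc zero ∷ G) v ≤ᵇ lookup b v) (λ v → ≤⇒≤ᵇ (raise (≤ᵇ⇒≤ 1 _ au) (≤ᵇ⇒≤ 1 _ aw) v (subst (deg ps G v ≤_) (lookup-use v) (below v)))))
  where
  lookup-use : ∀ v → lookup (use e b) v ≡ (if incident e v then pred (lookup b v) else lookup b v)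
  lookup-use v = Vec.lookup∘tabulate _ v

  positive : ∀ v → incident e v ≡ true → (if incident e v then 1 else 0) + deg ps G v ≤ lookup b v → T (1 ≤ᵇ lookup b v)
  positive v eq h rewrite eq = ≤⇒≤ᵇ (≤-trans (s≤s z≤n) h)

  lower : ∀ v → (if incident e v then 1 else 0) + deg ps G v ≤ lookup b v → deg ps G v ≤ (if incident e v then pred (lookup b v) else lookup b v)
  lower v h with incident e v
  ... | true  = pred-mono-≤ h
  ... | false = h

  endpoint : ∀ {m n d} → (T (toℕ m ≡ᵇ toℕ n)) → 1 ≤ lookup b m → d ≤ pred (lookup b n) → suc d ≤ lookup b n
  endpoint {m} {n} eq pos h with refl ← Fin.toℕ-injective {i = m} {n} (≡ᵇ⇒≡ _ _ eq) with lookup b m | pos | h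
  ... | suc _ | _ | h′ = s≤s h′

  raise : 1 ≤ lookup b u → 1 ≤ lookup b w → ∀ v →
    deg ps G v ≤ (if incident e v then pred (lookup b v) else lookup b v) → (if incident e v then 1 else 0) + deg ps G v ≤ lookup b v
  raise pu pw v h with toℕ u ≡ᵇ toℕ v in eu | toℕ w ≡ᵇ toℕ v in ew
  ... | true  | _     = endpoint (subst T (sym eu) tt) pu h
  ... | false | true  = endpoint (subst T (sym ew) tt) pw h
  ... | false | false = h

-- The multiplicity of the first edge splits the vectors into three blocks: 0 keeps the bounds, 1
-- uses the edge, 2 is rejected by `simple`.
count-simple : ∀ (ps : List (Edge N)) b →
  count (λ G → fits b ps G ∧ simple G) (vecs (allFin 3) (length ps)) ≡ ∑graphs ps b (const 1)
count-simple {N} [] b rewrite T-ext {fits b [] []} {true} (λ _ → tt) (λ _ → all-allFin⁺ {N} (λ v → 0 ≤ᵇ lookup b v) (λ _ → tt)) = refl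
count-simple {N} (e ∷ ps) b = begin
  count P (map (zero ∷_) V ++ map (suc zero ∷_) V ++ map (suc (suc zero) ∷_) V ++ [])
    ≡⟨ trans (count-++ P (map (zero ∷_) V) _) (cong (count P (map (zero ∷_) V) +_)
         (trans (count-++ P (map (suc zero ∷_) V) _) (cong (count P (map (suc zero ∷_) V) +_)
           (count-++ P (map (suc (suc zero) ∷_) V) [])))) ⟩
  count P (map (zero ∷_) V) + (count P (map (suc zero ∷_) V) + (count P (map (suc (suc zero) ∷_) V) + 0))
    ≡⟨ cong₂ _+_ (trans (count-map P _ V) (trans (count-cong P0 V) (count-simple ps b)))
         (trans (cong₂ _+_ (trans (count-map P _ V) (trans (count-cong P1 V) (trans (count-∧ˡ (available e b) _ V)
             (cong (λ x → if available e b then x else 0) (count-simple ps (use e b))))))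
           (trans (+-identityʳ _) (trans (count-map P _ V) (trans (count-cong P2 V) (count-false V))))) (+-identityʳ _)) ⟩
  ∑graphs (e ∷ ps) b (const 1) ∎
  where
  open ≡-Reasoning
  V = vecs (allFin 3) (length ps)

  P : Vec (Fin 3) (suc (length ps)) → Bool
  P G = fits b (e ∷ ps) G ∧ simple G

  P0 : ∀ G → P (zero ∷ G) ≡ fits b ps G ∧ simple G
  P0 G = cong (_∧ simple G) (all-allFin-cong (λ v → cong (λ x → x + deg ps G v ≤ᵇ lookup b v) (Bool.if-eta (incident e v))))

  P1 : ∀ G → P (suc zero ∷ G) ≡ available e b ∧ (fits (use e b) ps G ∧ simple G)
  P1 G = trans (cong (_∧ simple G) (fits-1∷ b e ps G)) (Bool.∧-assoc (available e b) _ _)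

  P2 : ∀ G → P (suc (suc zero) ∷ G) ≡ false
  P2 G = Bool.∧-zeroʳ _

-- Splitting off the first vertex

ascending : Edge N → Bool
ascending p = toℕ (proj₁ p) <ᵇ toℕ (proj₂ p)

shift : Edge N → Edge (suc N)
shift (u , w) = suc u , suc w

filterᵇ-ascending-shift : ∀ (ps : List (Edge N)) → filterᵇ ascending (map shift ps) ≡ map shift (filterᵇ ascending ps)
filterᵇ-ascending-shift [] = refl
filterᵇ-ascending-shift (p ∷ ps) with ascending p
... | true  = cong (shift p ∷_) (filterᵇ-ascending-shift ps)
... | false = filterᵇ-ascending-shift ps

-- The pairs at the first vertex come first and form a star. A later row loses its pair with `zero`,
-- which is not ascending, and is otherwise a shifted row of `pairs N`.
pairs-suc : ∀ N → pairs (suc N) ≡ map (λ j → zero , suc j) (allFin N) ++ map shift (pairs N)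
pairs-suc N = cong₂ _++_ star rest
  where
  open ≡-Reasoning
  row : ∀ N → Fin N → List (Edge N)
  row N i = filterᵇ ascending (map (i ,_) (allFin N))

  map-suc : ∀ i → map (i ,_) (List.tabulate suc) ≡ map (λ j → i , suc j) (allFin N)
  map-suc i = trans (List.map-tabulate suc (i ,_)) (sym (List.map-tabulate id (λ j → i , suc j)))

  all-ascending : ∀ (js : List (Fin N)) → filterᵇ ascending (map (λ j → zero , suc j) js) ≡ map (λ j → zero , suc j) js
  all-ascending []       = refl
  all-ascending (j ∷ js) = cong ((zero , suc j) ∷_) (all-ascending js)

  star : row (suc N) zero ≡ map (λ j → zero , suc j) (allFin N)
  star = trans (cong (filterᵇ ascending) (map-suc zero)) (all-ascending (allFin N))

  row-suc : ∀ i → row (suc N) (suc i) ≡ map shift (row N i)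
  row-suc i = trans (cong (filterᵇ ascending) (trans (map-suc (suc i)) (List.map-∘ (allFin N))))
    (filterᵇ-ascending-shift (map (i ,_) (allFin N)))

  rest : concatMap (row (suc N)) (List.tabulate suc) ≡ map shift (pairs N)
  rest = begin
    concatMap (row (suc N)) (List.tabulate suc)
      ≡⟨ cong (concatMap (row (suc N))) (sym (List.map-tabulate id suc)) ⟩
    concatMap (row (suc N)) (map suc (allFin N))
      ≡⟨ List.concatMap-map (row (suc N)) suc (allFin N) ⟩
    concatMap (row (suc N) ∘ suc) (allFin N)
      ≡⟨ List.concatMap-cong row-suc (allFin N) ⟩
    concatMap (map shift ∘ row N) (allFin N)
      ≡⟨ sym (List.map-concatMap shift (row N) (allFin N)) ⟩
    map shift (pairs N) ∎

if-cong : ∀ c {x y : ℕ} → x ≡ y → (if c then x else 0) ≡ (if c then y else 0)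
if-cong c = cong (λ x → if c then x else 0)

∑graphs-++ : ∀ (ps qs : List (Edge N)) b κ → ∑graphs (ps ++ qs) b κ ≡ ∑graphs ps b (λ b′ → ∑graphs qs b′ κ)
∑graphs-++ [] qs b κ = refl
∑graphs-++ (e ∷ ps) qs b κ = cong₂ _+_ (∑graphs-++ ps qs b κ) (if-cong (available e b) (∑graphs-++ ps qs (use e b) κ))

∑graphs-cong : ∀ (ps : List (Edge N)) {κ κ′} → (∀ b → κ b ≡ κ′ b) → ∀ b → ∑graphs ps b κ ≡ ∑graphs ps b κ′
∑graphs-cong [] eq b = eq b
∑graphs-cong (e ∷ ps) eq b = cong₂ _+_ (∑graphs-cong ps eq b) (if-cong (available e b) (∑graphs-cong ps eq (use e b)))

∑graphs-shift : ∀ (ps : List (Edge N)) c b κ → ∑graphs (map shift ps) (c ∷ b) κ ≡ ∑graphs ps b (κ ∘ (c ∷_))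
∑graphs-shift [] c b κ = refl
∑graphs-shift (e ∷ ps) c b κ = cong₂ _+_ (∑graphs-shift ps c b κ) (if-cong (available e b) (∑graphs-shift ps c (use e b) κ))

-- Sums κ of the residual bounds over the sets of at most c neighbours for one more vertex.
∑nbrs : ℕ → Vec ℕ N → (Vec ℕ N → ℕ) → ℕ
∑nbrs c []      κ = κ []
∑nbrs c (x ∷ b) κ = ∑nbrs c b (κ ∘ (x ∷_)) + (if (1 ≤ᵇ c) ∧ (1 ≤ᵇ x) then ∑nbrs (pred c) b (κ ∘ (pred x ∷_)) else 0)

-- No edge of this list meets the vertex with bound `x`. `tail` forgets the residual bound of the
-- centre, which no later edge meets.
∑graphs-star-∷ : ∀ (js : List (Fin N)) c x b (κ : Vec ℕ (suc N) → ℕ) →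
  ∑graphs (map (λ j → zero , suc (suc j)) js) (c ∷ x ∷ b) (κ ∘ tail) ≡
  ∑graphs (map (λ j → zero , suc j) js) (c ∷ b) (κ ∘ (x ∷_) ∘ tail)
∑graphs-star-∷ [] c x b κ = refl
∑graphs-star-∷ (j ∷ js) c x b κ = cong₂ _+_ (∑graphs-star-∷ js c x b κ)
  (if-cong (available (zero , suc j) (c ∷ b)) (∑graphs-star-∷ js (pred c) x _ κ))

∑graphs-star : ∀ c (b : Vec ℕ N) κ → ∑graphs (map (λ j → zero , suc j) (allFin N)) (c ∷ b) (κ ∘ tail) ≡ ∑nbrs c b κ
∑graphs-star c [] κ = refl
∑graphs-star {suc N} c (x ∷ b) κ = cong₂ _+_ (tails c x refl)
  -- `use` rebuilds the untouched bounds with `tabulate`, so they equal `b` only propositionally.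
  (if-cong ((1 ≤ᵇ c) ∧ (1 ≤ᵇ x)) (tails (pred c) (pred x) (Vec.tabulate∘lookup b)))
  where
  neighbours : map (λ j → zero , suc j) (List.tabulate (suc {N})) ≡ map (λ j → zero , suc (suc j)) (allFin N)
  neighbours = trans (List.map-tabulate suc (λ j → zero , suc j)) (sym (List.map-tabulate id (λ j → zero , suc (suc j))))

  tails : ∀ c x {b′} → b′ ≡ b →
    ∑graphs (map (λ j → zero , suc j) (List.tabulate suc)) (c ∷ x ∷ b′) (κ ∘ tail) ≡ ∑nbrs c b (κ ∘ (x ∷_))
  tails c x refl = trans (cong (λ ps → ∑graphs ps (c ∷ x ∷ b) (κ ∘ tail)) neighbours)
    (trans (∑graphs-star-∷ (allFin N) c x b κ) (∑graphs-star c b (κ ∘ (x ∷_))))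

∑graphs-pairs-suc : ∀ c (b : Vec ℕ N) → ∑graphs (pairs (suc N)) (c ∷ b) (const 1) ≡ ∑nbrs c b (λ b′ → ∑graphs (pairs N) b′ (const 1))
∑graphs-pairs-suc {N} c b = begin
  ∑graphs (pairs (suc N)) (c ∷ b) (const 1)
    ≡⟨ cong (λ ps → ∑graphs ps (c ∷ b) (const 1)) (pairs-suc N) ⟩
  ∑graphs (star ++ map shift (pairs N)) (c ∷ b) (const 1)
    ≡⟨ ∑graphs-++ star _ (c ∷ b) (const 1) ⟩
  ∑graphs star (c ∷ b) (λ b′ → ∑graphs (map shift (pairs N)) b′ (const 1))
    ≡⟨ ∑graphs-cong star (λ { (x ∷ b′) → ∑graphs-shift (pairs N) x b′ (const 1) }) (c ∷ b) ⟩
  ∑graphs star (c ∷ b) ((λ b′ → ∑graphs (pairs N) b′ (const 1)) ∘ tail)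
    ≡⟨ ∑graphs-star c b _ ⟩
  ∑nbrs c b (λ b′ → ∑graphs (pairs N) b′ (const 1)) ∎
  where
  open ≡-Reasoning
  star = map (λ j → zero , suc j) (allFin N)

∑nbrs-cong : ∀ c {b : Vec ℕ N} {κ κ′} → All (_≤ 2) b → (∀ {b} → All (_≤ 2) b → κ b ≡ κ′ b) → ∑nbrs c b κ ≡ ∑nbrs c b κ′
∑nbrs-cong c [] eq = eq []
∑nbrs-cong c {x ∷ b} (x≤2 ∷ b≤2) eq = cong₂ _+_ (∑nbrs-cong c b≤2 (λ a → eq (x≤2 ∷ a)))
  (if-cong ((1 ≤ᵇ c) ∧ (1 ≤ᵇ x)) (∑nbrs-cong (pred c) b≤2 (λ a → eq (≤-trans (pred[n]≤n {x}) x≤2 ∷ a))))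

twos ones : Vec ℕ N → ℕ
twos []      = 0
twos (2 ∷ b) = suc (twos b)
twos (_ ∷ b) = twos b
ones []      = 0
ones (1 ∷ b) = suc (ones b)
ones (_ ∷ b) = ones b

∑nbrs-0 : ∀ (b : Vec ℕ N) κ → ∑nbrs 0 b κ ≡ κ b
∑nbrs-0 []      κ = refl
∑nbrs-0 (x ∷ b) κ = trans (+-identityʳ _) (∑nbrs-0 b (κ ∘ (x ∷_)))

-- `φ` is free because a first entry 1 or 2, if not chosen, raises one of its arguments. Choosing
-- that entry gives the extra unit in the factor `suc (ones b)` or `suc (twos b)`.
∑nbrs-1 : ∀ {b : Vec ℕ N} → All (_≤ 2) b → ∀ (φ : ℕ → ℕ → ℕ) →
  ∑nbrs 1 b (λ b′ → φ (twos b′) (ones b′)) ≡ step₁ (φ (twos b)) (φ (pred (twos b))) (twos b) (ones b)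
∑nbrs-1 [] φ = sym (trans (+-identityʳ _) (+-identityʳ _))
∑nbrs-1 (z≤n ∷ b≤2) φ = trans (+-identityʳ _) (∑nbrs-1 b≤2 φ)
∑nbrs-1 {b = _ ∷ b} (s≤s z≤n ∷ b≤2) φ = begin
  ∑nbrs 1 b (λ b′ → φ (twos b′) (suc (ones b′))) + ∑nbrs 0 b (λ b′ → φ (twos b′) (ones b′))
    ≡⟨ cong₂ _+_ (∑nbrs-1 b≤2 (λ p q → φ p (suc q))) (∑nbrs-0 b _) ⟩
  φ p (suc q) + p * φ (pred p) (suc (suc q)) + q * φ p (suc (pred q)) + φ p q
    ≡⟨ cong (λ x → φ p (suc q) + p * φ (pred p) (suc (suc q)) + x + φ p q) (pred-irr q (φ p)) ⟩
  φ p (suc q) + p * φ (pred p) (suc (suc q)) + q * φ p q + φ p q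
    ≡⟨ lemma (φ p (suc q)) (p * φ (pred p) (suc (suc q))) q (φ p q) ⟩
  φ p (suc q) + p * φ (pred p) (suc (suc q)) + suc q * φ p q ∎
  where
  open ≡-Reasoning
  p = twos b
  q = ones b
  lemma : ∀ x y q z → x + y + q * z + z ≡ x + y + suc q * z
  lemma = solve-∀
∑nbrs-1 {b = _ ∷ b} (s≤s (s≤s z≤n) ∷ b≤2) φ = begin
  ∑nbrs 1 b (λ b′ → φ (suc (twos b′)) (ones b′)) + ∑nbrs 0 b (λ b′ → φ (twos b′) (suc (ones b′)))
    ≡⟨ cong₂ _+_ (∑nbrs-1 b≤2 (λ p q → φ (suc p) q)) (∑nbrs-0 b _) ⟩
  φ (suc p) q + p * φ (suc (pred p)) (suc q) + q * φ (suc p) (pred q) + φ p (suc q)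
    ≡⟨ cong (λ x → φ (suc p) q + x + q * φ (suc p) (pred q) + φ p (suc q)) (pred-irr p (λ p → φ p (suc q))) ⟩
  φ (suc p) q + p * φ p (suc q) + q * φ (suc p) (pred q) + φ p (suc q)
    ≡⟨ lemma (φ (suc p) q) p (φ p (suc q)) (q * φ (suc p) (pred q)) ⟩
  φ (suc p) q + suc p * φ p (suc q) + q * φ (suc p) (pred q) ∎
  where
  open ≡-Reasoning
  p = twos b
  q = ones b
  lemma : ∀ x p y z → x + p * y + z + y ≡ x + suc p * y + z
  lemma = solve-∀

tri-irr : ∀ m (f : ℕ → ℕ) → tri m * f (suc (pred (pred m))) ≡ tri m * f (pred m)
tri-irr 0 f = refl
tri-irr 1 f = refl
tri-irr (suc (suc m)) f = refl

-- Once the first entry is chosen, at most one neighbour is left to choose, which is `∑nbrs-1`. The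
-- pairs containing that entry are those added by the recursion of `tri` or by the product of the
-- two factors.
∑nbrs-2 : ∀ {b : Vec ℕ N} → All (_≤ 2) b → ∀ (φ : ℕ → ℕ → ℕ) →
  ∑nbrs 2 b (λ b′ → φ (twos b′) (ones b′)) ≡ step₂ (φ (twos b)) (φ (pred (twos b))) (φ (pred (pred (twos b)))) (twos b) (ones b)
∑nbrs-2 [] φ = sym (trans (+-identityʳ _) (trans (+-identityʳ _) (+-identityʳ _)))
∑nbrs-2 (z≤n ∷ b≤2) φ = trans (+-identityʳ _) (∑nbrs-2 b≤2 φ)
∑nbrs-2 {b = _ ∷ b} (s≤s z≤n ∷ b≤2) φ = begin
  ∑nbrs 2 b (λ b′ → φ (twos b′) (suc (ones b′))) + ∑nbrs 1 b (λ b′ → φ (twos b′) (ones b′))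
    ≡⟨ cong₂ _+_ (∑nbrs-2 b≤2 (λ p q → φ p (suc q))) (∑nbrs-1 b≤2 φ) ⟩
  φ p (suc q) + p * φ (pred p) (2 + q) + q * φ p (suc (pred q))
    + (tri p * φ (pred (pred p)) (3 + q) + p * (q * φ (pred p) (suc q)) + tri q * φ p (suc (pred (pred q))))
    + (φ p q + p * φ (pred p) (suc q) + q * φ p (pred q))
    ≡⟨ cong₂ (λ x y → φ p (suc q) + p * φ (pred p) (2 + q) + x
        + (tri p * φ (pred (pred p)) (3 + q) + p * (q * φ (pred p) (suc q)) + y) + (φ p q + p * φ (pred p) (suc q) + q * φ p (pred q)))
        (pred-irr q (φ p)) (tri-irr q (φ p)) ⟩
  φ p (suc q) + p * φ (pred p) (2 + q) + q * φ p q
    + (tri p * φ (pred (pred p)) (3 + q) + p * (q * φ (pred p) (suc q)) + tri q * φ p (pred q))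
    + (φ p q + p * φ (pred p) (suc q) + q * φ p (pred q))
    ≡⟨ lemma (φ p (suc q)) (p * φ (pred p) (2 + q)) q (φ p q) (tri p * φ (pred (pred p)) (3 + q)) p (φ (pred p) (suc q)) (tri q) (φ p (pred q)) ⟩
  φ p (suc q) + p * φ (pred p) (2 + q) + suc q * φ p q
    + (tri p * φ (pred (pred p)) (3 + q) + p * (suc q * φ (pred p) (suc q)) + (q + tri q) * φ p (pred q)) ∎
  where
  open ≡-Reasoning
  p = twos b
  q = ones b
  lemma : ∀ a b q c d p e f h → a + b + q * c + (d + p * (q * e) + f * h) + (c + p * e + q * h) ≡
    a + b + suc q * c + (d + p * (suc q * e) + (q + f) * h)
  lemma = solve-∀
∑nbrs-2 {b = _ ∷ b} (s≤s (s≤s z≤n) ∷ b≤2) φ = begin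
  ∑nbrs 2 b (λ b′ → φ (suc (twos b′)) (ones b′)) + ∑nbrs 1 b (λ b′ → φ (twos b′) (suc (ones b′)))
    ≡⟨ cong₂ _+_ (∑nbrs-2 b≤2 (λ p q → φ (suc p) q)) (∑nbrs-1 b≤2 (λ p q → φ p (suc q))) ⟩
  φ (suc p) q + p * φ (suc (pred p)) (suc q) + q * φ (suc p) (pred q)
    + (tri p * φ (suc (pred (pred p))) (2 + q) + p * (q * φ (suc (pred p)) q) + tri q * φ (suc p) (pred (pred q)))
    + (φ p (suc q) + p * φ (pred p) (2 + q) + q * φ p (suc (pred q)))
    ≡⟨ cong₂ _+_ (cong₂ _+_ (cong (λ x → φ (suc p) q + x + q * φ (suc p) (pred q)) (pred-irr p (λ p → φ p (suc q))))
        (cong₂ (λ x y → x + y + tri q * φ (suc p) (pred (pred q))) (tri-irr p (λ p → φ p (2 + q))) (pred-irr p (λ p → q * φ p q))))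
        (cong (φ p (suc q) + p * φ (pred p) (2 + q) +_) (pred-irr q (φ p))) ⟩
  φ (suc p) q + p * φ p (suc q) + q * φ (suc p) (pred q)
    + (tri p * φ (pred p) (2 + q) + p * (q * φ p q) + tri q * φ (suc p) (pred (pred q)))
    + (φ p (suc q) + p * φ (pred p) (2 + q) + q * φ p q)
    ≡⟨ lemma (φ (suc p) q) p (φ p (suc q)) (q * φ (suc p) (pred q)) (tri p) (φ (pred p) (2 + q)) q (φ p q) _ ⟩
  φ (suc p) q + suc p * φ p (suc q) + q * φ (suc p) (pred q)
    + ((p + tri p) * φ (pred p) (2 + q) + suc p * (q * φ p q) + tri q * φ (suc p) (pred (pred q))) ∎
  where
  open ≡-Reasoning
  p = twos b
  q = ones b
  lemma : ∀ a p b c t d q e f → a + p * b + c + (t * d + p * (q * e) + f) + (b + p * d + q * e) ≡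
    a + suc p * b + c + ((p + t) * d + suc p * (q * e) + f)
  lemma = solve-∀

-- The first vertex may have any bound up to 2. Bound 2 matches the definition of `γ`, while bound 1
-- needs `γ-step₁`, the recurrence obtained by inverting the transform.
∑graphs-pairs : ∀ {b : Vec ℕ N} → All (_≤ 2) b → ∑graphs (pairs N) b (const 1) ≡ γ (twos b) (ones b)
∑graphs-pairs [] = refl
∑graphs-pairs {b = c ∷ b} (c≤2 ∷ b≤2) =
  trans (∑graphs-pairs-suc c b) (trans (∑nbrs-cong c b≤2 ∑graphs-pairs) (neighbourhoods c≤2))
  where
  neighbourhoods : ∀ {c} → c ≤ 2 → ∑nbrs c b (λ b′ → γ (twos b′) (ones b′)) ≡ γ (twos (c ∷ b)) (ones (c ∷ b))
  neighbourhoods z≤n             = ∑nbrs-0 b _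
  neighbourhoods (s≤s z≤n)       = trans (∑nbrs-1 b≤2 γ) (sym (γ-step₁ (twos b) (ones b)))
  neighbourhoods (s≤s (s≤s z≤n)) = trans (∑nbrs-2 b≤2 γ) (sym (γ-suc (twos b) (ones b)))

-- The degree bounds of 𝔊_m

bounds : ∀ u ρ → Vec ℕ (u + ρ)
bounds u ρ = tabulate (λ v → if toℕ v ≡ᵇ u then 1 else 2)

bounds-≤2 : ∀ u ρ → All (_≤ 2) (bounds u ρ)
bounds-≤2 u ρ = go (u + ρ) toℕ
  where
  -- `toℕ` is generalised to `f`, as the tail is tabulated with `toℕ ∘ suc`.
  go : ∀ n (f : Fin n → ℕ) → All (_≤ 2) (tabulate (λ v → if f v ≡ᵇ u then 1 else 2))
  go zero    f = []
  go (suc n) f with f zero ≡ᵇ u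
  ... | true  = s≤s z≤n ∷ go n (f ∘ suc)
  ... | false = ≤-refl ∷ go n (f ∘ suc)

twos-bounds : ∀ u {ρ} → ρ < 2 → twos (bounds u ρ) ≡ u
twos-bounds zero (s≤s z≤n)       = refl
twos-bounds zero (s≤s (s≤s z≤n)) = refl
twos-bounds (suc u) ρ<2          = cong suc (twos-bounds u ρ<2)

ones-bounds : ∀ u {ρ} → ρ < 2 → ones (bounds u ρ) ≡ ρ
ones-bounds zero (s≤s z≤n)       = refl
ones-bounds zero (s≤s (s≤s z≤n)) = refl
ones-bounds (suc u) ρ<2          = ones-bounds u ρ<2

g≡γ : ∀ m → g m ≡ γ (m / 2) (m % 2)
g≡γ m = begin
  g m
    ≡⟨ count-filterᵇ (inG m) (noDoubleEdge m) (allMGraphs m) ⟩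
  count (λ G → inG m G ∧ noDoubleEdge m G) (allMGraphs m)
    ≡⟨ count-cong (λ G → cong (_∧ noDoubleEdge m G) (all-allFin-cong (bound G))) (allMGraphs m) ⟩
  count (λ G → fits b (pairs (numV m)) G ∧ simple G) (allMGraphs m)
    ≡⟨ count-simple (pairs (numV m)) b ⟩
  ∑graphs (pairs (numV m)) b (const 1)
    ≡⟨ ∑graphs-pairs (bounds-≤2 (m / 2) (m % 2)) ⟩
  γ (twos b) (ones b)
    ≡⟨ cong₂ γ (twos-bounds (m / 2) (m%n<n m 2)) (ones-bounds (m / 2) (m%n<n m 2)) ⟩
  γ (m / 2) (m % 2) ∎
  where
  open ≡-Reasoning
  b = bounds (m / 2) (m % 2)

  meet : ∀ d s → (d ≤ᵇ 2) ∧ (not s ∨ (d ≤ᵇ 1)) ≡ (d ≤ᵇ (if s then 1 else 2))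
  meet d false = Bool.∧-identityʳ _
  meet 0 true = refl
  meet 1 true = refl
  meet 2 true = refl
  meet (suc (suc (suc d))) true = refl

  bound : ∀ G v → (degree m G v ≤ᵇ 2) ∧ (not (toℕ v ≡ᵇ m / 2) ∨ (degree m G v ≤ᵇ 1)) ≡ (deg (pairs (numV m)) G v ≤ᵇ lookup b v)
  bound G v = trans (meet (degree m G v) (toℕ v ≡ᵇ m / 2)) (cong (degree m G v ≤ᵇ_) (sym (Vec.lookup∘tabulate _ v)))

-- The coefficients C(k,i) (1;2)_{k+s} / (1;2)_{i+s}

∑< : ℕ → (ℕ → ℕ) → ℕ
∑< n f = sum (applyUpTo f n)

∑<-cong : ∀ n {f h} → (∀ i → f i ≡ h i) → ∑< n f ≡ ∑< n h
∑<-cong zero    eq = refl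
∑<-cong (suc n) eq = cong₂ _+_ (eq 0) (∑<-cong n (eq ∘ suc))

∑<-+ : ∀ n f h → ∑< n (λ i → f i + h i) ≡ ∑< n f + ∑< n h
∑<-+ zero    f h = refl
∑<-+ (suc n) f h = trans (cong (f 0 + h 0 +_) (∑<-+ n (f ∘ suc) (h ∘ suc)))
  (+-lemma (f 0) (h 0) (∑< n (f ∘ suc)) (∑< n (h ∘ suc)))
  where
  +-lemma : ∀ a b c d → a + b + (c + d) ≡ a + c + (b + d)
  +-lemma = solve-∀

∑<-* : ∀ n c f → ∑< n (λ i → c * f i) ≡ c * ∑< n f
∑<-* zero    c f = sym (*-zeroʳ c)
∑<-* (suc n) c f = trans (cong (c * f 0 +_) (∑<-* n c (f ∘ suc))) (sym (*-distribˡ-+ c (f 0) _))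

∑<-drop-last : ∀ n f → f n ≡ 0 → ∑< (suc n) f ≡ ∑< n f
∑<-drop-last zero    f fn≡0 = trans (+-identityʳ (f 0)) fn≡0
∑<-drop-last (suc n) f fn≡0 = cong (f 0 +_) (∑<-drop-last n (f ∘ suc) fn≡0)

-- In closed form, coeff₀ k i = C(k,i) (1;2)_k / (1;2)_i and coeff₁ k i = C(k,i) (1;2)_{k+1} / (1;2)_{i+1}.
coeff₀ coeff₁ : ℕ → ℕ → ℕ
coeff₀ zero    zero    = 1
coeff₀ zero    (suc i) = 0
coeff₀ (suc k) zero    = suc (2 * k) * coeff₀ k zero
coeff₀ (suc k) (suc i) = coeff₁ k i + suc (2 * k) * coeff₀ k (suc i)
coeff₁ zero    zero    = 1
coeff₁ zero    (suc i) = 0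
coeff₁ (suc k) i       = coeff₀ (suc k) i + 2 * suc k * coeff₁ k i

coeff₀-vanishes : ∀ k i → k < i → coeff₀ k i ≡ 0
coeff₁-vanishes : ∀ k i → k < i → coeff₁ k i ≡ 0
coeff₀-vanishes zero    (suc i) k<i       = refl
coeff₀-vanishes (suc k) (suc i) (s≤s k<i)
  rewrite coeff₁-vanishes k i k<i | coeff₀-vanishes k (suc i) (m<n⇒m<1+n k<i) = *-zeroʳ (suc (2 * k))
coeff₁-vanishes zero    (suc i) k<i       = refl
coeff₁-vanishes (suc k) i       k<i
  rewrite coeff₀-vanishes (suc k) i k<i | coeff₁-vanishes k i (<-trans (n<1+n k) k<i) = *-zeroʳ (2 * suc k)

-- `coeff₀ k i` and `coeff₁ k i` number the matchings of 2k and 2k + 1 vertices that leave 2i and 2i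
-- + 1 unmatched. Setting one vertex aside changes the parity, hence the mutual induction.
matchSum-even : ∀ k f → matchSum (2 * k) f ≡ 2 ^ k * ∑< (suc k) (λ i → 2 ^ i * (coeff₀ k i * f (2 * i)))
matchSum-odd  : ∀ k f → matchSum (suc (2 * k)) f ≡ 2 ^ suc k * ∑< (suc k) (λ i → 2 ^ i * (coeff₁ k i * f (suc (2 * i))))
matchSum-even zero f = lemma (f 0)
  where
  lemma : ∀ x → x ≡ 1 * (1 * (1 * x) + 0)
  lemma = solve-∀
matchSum-even (suc k) f = begin
  matchSum (2 * suc k) f
    ≡⟨ cong (λ n → matchSum n f) (*-suc 2 k) ⟩
  2 * matchSum (suc (2 * k)) (f ∘ suc) + 2 * suc (2 * k) * matchSum (2 * k) f
    ≡⟨ cong₂ (λ x y → 2 * x + 2 * suc (2 * k) * y) (matchSum-odd k (f ∘ suc)) (matchSum-even k f) ⟩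
  2 * (2 ^ suc k * ∑< (suc k) a) + 2 * suc (2 * k) * (2 ^ k * ∑< (suc k) b)
    ≡⟨ lemma₁ (2 ^ k) (∑< (suc k) a) (suc (2 * k)) (∑< (suc k) b) ⟩
  2 ^ suc k * (suc (2 * k) * ∑< (suc k) b + 2 * ∑< (suc k) a)
    -- The summand `suc k` of `b` is 0; adding it lets the sum be split at 0 and aligned with that
    -- of `a`.
    ≡⟨ cong (λ x → 2 ^ suc k * (suc (2 * k) * x + 2 * ∑< (suc k) a)) (sym (∑<-drop-last (suc k) b
         (trans (cong (λ x → 2 ^ suc k * (x * f (2 * suc k))) (coeff₀-vanishes k (suc k) (n<1+n k))) (*-zeroʳ (2 ^ suc k))))) ⟩
  2 ^ suc k * (suc (2 * k) * (b 0 + ∑< (suc k) (b ∘ suc)) + 2 * ∑< (suc k) a)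
    ≡⟨ cong (2 ^ suc k *_) (lemma₂ (suc (2 * k)) (b 0) (∑< (suc k) (b ∘ suc)) (∑< (suc k) a)) ⟩
  2 ^ suc k * (suc (2 * k) * b 0 + (2 * ∑< (suc k) a + suc (2 * k) * ∑< (suc k) (b ∘ suc)))
    ≡⟨ cong (2 ^ suc k *_) (cong₂ _+_ (lemma₃ (suc (2 * k)) (coeff₀ k 0) (f 0))
         (trans (cong₂ _+_ (sym (∑<-* (suc k) 2 a)) (sym (∑<-* (suc k) (suc (2 * k)) (b ∘ suc))))
           (trans (sym (∑<-+ (suc k) (λ i → 2 * a i) (λ i → suc (2 * k) * b (suc i)))) (∑<-cong (suc k) term)))) ⟩
  2 ^ suc k * ∑< (suc (suc k)) (λ i → 2 ^ i * (coeff₀ (suc k) i * f (2 * i))) ∎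
  where
  open ≡-Reasoning
  a b : ℕ → ℕ
  a i = 2 ^ i * (coeff₁ k i * f (suc (suc (2 * i))))
  b i = 2 ^ i * (coeff₀ k i * f (2 * i))
  lemma₁ : ∀ p x m y → 2 * (2 * p * x) + 2 * m * (p * y) ≡ 2 * p * (m * y + 2 * x)
  lemma₁ = solve-∀
  lemma₂ : ∀ m x y z → m * (x + y) + 2 * z ≡ m * x + (2 * z + m * y)
  lemma₂ = solve-∀
  lemma₃ : ∀ m c x → m * (1 * (c * x)) ≡ 1 * (m * c * x)
  lemma₃ = solve-∀
  lemma₄ : ∀ p c m d x → 2 * (p * (c * x)) + m * (2 * p * (d * x)) ≡ 2 * p * ((c + m * d) * x)
  lemma₄ = solve-∀
  term : ∀ i → 2 * a i + suc (2 * k) * b (suc i) ≡ 2 ^ suc i * (coeff₀ (suc k) (suc i) * f (2 * suc i))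
  term i rewrite *-suc 2 i = lemma₄ (2 ^ i) (coeff₁ k i) (suc (2 * k)) (coeff₀ k (suc i)) (f (suc (suc (2 * i))))
matchSum-odd zero f = lemma (f 1)
  where
  lemma : ∀ x → 2 * x ≡ 2 * (1 * (1 * x) + 0)
  lemma = solve-∀
matchSum-odd (suc k) f = begin
  matchSum (suc (2 * suc k)) f
    ≡⟨ matchSum-suc (2 * suc k) f ⟩
  2 * matchSum (2 * suc k) (f ∘ suc) + 2 * (2 * suc k) * matchSum (pred (2 * suc k)) f
    ≡⟨ cong₂ (λ x y → 2 * x + 2 * (2 * suc k) * y) (matchSum-even (suc k) (f ∘ suc))
         (trans (cong (λ n → matchSum (pred n) f) (*-suc 2 k)) (matchSum-odd k f)) ⟩
  2 * (2 ^ suc k * ∑< (suc (suc k)) a) + 2 * (2 * suc k) * (2 ^ suc k * ∑< (suc k) b)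
    ≡⟨ lemma₁ (2 ^ suc k) (∑< (suc (suc k)) a) (2 * suc k) (∑< (suc k) b) ⟩
  2 ^ suc (suc k) * (∑< (suc (suc k)) a + 2 * suc k * ∑< (suc k) b)
    ≡⟨ cong (λ x → 2 ^ suc (suc k) * (∑< (suc (suc k)) a + 2 * suc k * x)) (sym (∑<-drop-last (suc k) b
         (trans (cong (λ x → 2 ^ suc k * (x * f (suc (2 * suc k)))) (coeff₁-vanishes k (suc k) (n<1+n k))) (*-zeroʳ (2 ^ suc k))))) ⟩
  2 ^ suc (suc k) * (∑< (suc (suc k)) a + 2 * suc k * ∑< (suc (suc k)) b)
    ≡⟨ cong (2 ^ suc (suc k) *_) (trans (cong (∑< (suc (suc k)) a +_) (sym (∑<-* (suc (suc k)) (2 * suc k) b)))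
         (trans (sym (∑<-+ (suc (suc k)) a (λ i → 2 * suc k * b i))) (∑<-cong (suc (suc k))
           (λ i → lemma₂ (2 ^ i) (coeff₀ (suc k) i) (2 * suc k) (coeff₁ k i) (f (suc (2 * i))))))) ⟩
  2 ^ suc (suc k) * ∑< (suc (suc k)) (λ i → 2 ^ i * (coeff₁ (suc k) i * f (suc (2 * i)))) ∎
  where
  open ≡-Reasoning
  a b : ℕ → ℕ
  a i = 2 ^ i * (coeff₀ (suc k) i * f (suc (2 * i)))
  b i = 2 ^ i * (coeff₁ k i * f (suc (2 * i)))
  lemma₁ : ∀ p x m y → 2 * (p * x) + 2 * m * (p * y) ≡ 2 * p * (x + m * y)
  lemma₁ = solve-∀
  lemma₂ : ∀ p c m d x → p * (c * x) + m * (p * (d * x)) ≡ p * ((c + m * d) * x)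
  lemma₂ = solve-∀

-- Both sides count subsets of size k + 1 of n + 1 elements with a marked member.
C-absorption : ∀ n k → suc k * (suc n C suc k) ≡ suc n * (n C k)
C-absorption zero    zero    = refl
C-absorption zero    (suc k) = *-zeroʳ (suc (suc k))
C-absorption (suc n) zero    = begin
  1 * (suc (suc n) C 1)
    ≡⟨ cong (1 *_) (sym (nCk+nC[k+1]≡[n+1]C[k+1] (suc n) 0)) ⟩
  1 * (1 + (suc n C 1))
    ≡⟨ *-distribˡ-+ 1 1 (suc n C 1) ⟩
  1 + 1 * (suc n C 1)
    ≡⟨ cong suc (C-absorption n 0) ⟩
  suc (suc n) * 1 ∎
  where open ≡-Reasoning
C-absorption (suc n) (suc k) = begin
  suc (suc k) * (suc (suc n) C suc (suc k))
    ≡⟨ cong (suc (suc k) *_) (sym (nCk+nC[k+1]≡[n+1]C[k+1] (suc n) (suc k))) ⟩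
  suc (suc k) * (suc n C suc k + (suc n C suc (suc k)))
    ≡⟨ lemma₁ (suc k) (suc n C suc k) (suc n C suc (suc k)) ⟩
  (suc n C suc k) + suc k * (suc n C suc k) + suc (suc k) * (suc n C suc (suc k))
    ≡⟨ cong₂ (λ x y → (suc n C suc k) + x + y) (C-absorption n k) (C-absorption n (suc k)) ⟩
  (suc n C suc k) + suc n * (n C k) + suc n * (n C suc k)
    ≡⟨ lemma₂ (suc n C suc k) (suc n) (n C k) (n C suc k) ⟩
  (suc n C suc k) + suc n * (n C k + (n C suc k))
    ≡⟨ cong (λ x → (suc n C suc k) + suc n * x) (nCk+nC[k+1]≡[n+1]C[k+1] n k) ⟩
  suc (suc n) * (suc n C suc k) ∎
  where
  open ≡-Reasoning
  lemma₁ : ∀ k x y → suc k * (x + y) ≡ x + k * x + suc k * y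
  lemma₁ = solve-∀
  lemma₂ : ∀ c n x y → c + n * x + n * y ≡ c + n * (x + y)
  lemma₂ = solve-∀

-- A subset of size k and a marked element among n + 1: the mark lies inside the subset or outside
-- it.
C-symmetric-absorption : ∀ n k → k * (suc n C k) + suc n * (n C k) ≡ suc n * (suc n C k)
C-symmetric-absorption n zero    = refl
C-symmetric-absorption n (suc k) = begin
  suc k * (suc n C suc k) + suc n * (n C suc k)
    ≡⟨ cong (_+ suc n * (n C suc k)) (C-absorption n k) ⟩
  suc n * (n C k) + suc n * (n C suc k)
    ≡⟨ sym (*-distribˡ-+ (suc n) (n C k) (n C suc k)) ⟩
  suc n * (n C k + (n C suc k))
    ≡⟨ cong (suc n *_) (nCk+nC[k+1]≡[n+1]C[k+1] n k) ⟩
  suc n * (suc n C suc k) ∎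
  where open ≡-Reasoning

-- The quotient is cleared to stay in ℕ. The step for `coeff₀` reduces to Pascal's rule, that for
-- `coeff₁` to `C-symmetric-absorption`.
coeff₀-closed : ∀ k i → coeff₀ k i * poch 1 2 i ≡ (k C i) * poch 1 2 k
coeff₁-closed : ∀ k i → coeff₁ k i * poch 1 2 (suc i) ≡ (k C i) * poch 1 2 (suc k)
coeff₀-closed zero    zero    = refl
coeff₀-closed zero    (suc i) = refl
coeff₀-closed (suc k) zero    = begin
  suc (2 * k) * coeff₀ k 0 * 1
    ≡⟨ *-assoc (suc (2 * k)) (coeff₀ k 0) 1 ⟩
  suc (2 * k) * (coeff₀ k 0 * 1)
    ≡⟨ cong (suc (2 * k) *_) (coeff₀-closed k 0) ⟩
  suc (2 * k) * (1 * poch 1 2 k)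
    ≡⟨ lemma k (poch 1 2 k) ⟩
  1 * (poch 1 2 k * (1 + k * 2)) ∎
  where
  open ≡-Reasoning
  lemma : ∀ k p → suc (2 * k) * (1 * p) ≡ 1 * (p * (1 + k * 2))
  lemma = solve-∀
coeff₀-closed (suc k) (suc i) = begin
  (coeff₁ k i + suc (2 * k) * coeff₀ k (suc i)) * poch 1 2 (suc i)
    ≡⟨ lemma₁ (coeff₁ k i) (suc (2 * k)) (coeff₀ k (suc i)) (poch 1 2 (suc i)) ⟩
  coeff₁ k i * poch 1 2 (suc i) + suc (2 * k) * (coeff₀ k (suc i) * poch 1 2 (suc i))
    ≡⟨ cong₂ (λ x y → x + suc (2 * k) * y) (coeff₁-closed k i) (coeff₀-closed k (suc i)) ⟩
  (k C i) * (poch 1 2 k * (1 + k * 2)) + suc (2 * k) * ((k C suc i) * poch 1 2 k)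
    ≡⟨ lemma₂ (k C i) (k C suc i) (poch 1 2 k) k ⟩
  (k C i + (k C suc i)) * (poch 1 2 k * (1 + k * 2))
    ≡⟨ cong (_* poch 1 2 (suc k)) (nCk+nC[k+1]≡[n+1]C[k+1] k i) ⟩
  (suc k C suc i) * poch 1 2 (suc k) ∎
  where
  open ≡-Reasoning
  lemma₁ : ∀ a m b p → (a + m * b) * p ≡ a * p + m * (b * p)
  lemma₁ = solve-∀
  lemma₂ : ∀ c d p k → c * (p * (1 + k * 2)) + suc (2 * k) * (d * p) ≡ (c + d) * (p * (1 + k * 2))
  lemma₂ = solve-∀
coeff₁-closed zero    zero    = refl
coeff₁-closed zero    (suc i) = refl
coeff₁-closed (suc k) i       = begin
  (coeff₀ (suc k) i + 2 * suc k * coeff₁ k i) * (poch 1 2 i * (1 + i * 2))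
    ≡⟨ lemma₁ (coeff₀ (suc k) i) (2 * suc k) (coeff₁ k i) (poch 1 2 i) (1 + i * 2) ⟩
  coeff₀ (suc k) i * poch 1 2 i * (1 + i * 2) + 2 * suc k * (coeff₁ k i * poch 1 2 (suc i))
    ≡⟨ cong₂ (λ x y → x * (1 + i * 2) + 2 * suc k * y) (coeff₀-closed (suc k) i) (coeff₁-closed k i) ⟩
  (suc k C i) * poch 1 2 (suc k) * (1 + i * 2) + 2 * suc k * ((k C i) * poch 1 2 (suc k))
    ≡⟨ lemma₂ (suc k C i) (poch 1 2 (suc k)) i (suc k) (k C i) ⟩
  ((suc k C i) + 2 * (i * (suc k C i) + suc k * (k C i))) * poch 1 2 (suc k)
    ≡⟨ cong (λ x → ((suc k C i) + 2 * x) * poch 1 2 (suc k)) (C-symmetric-absorption k i) ⟩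
  ((suc k C i) + 2 * (suc k * (suc k C i))) * poch 1 2 (suc k)
    ≡⟨ lemma₃ (suc k C i) (suc k) (poch 1 2 (suc k)) ⟩
  (suc k C i) * (poch 1 2 (suc k) * (1 + suc k * 2)) ∎
  where
  open ≡-Reasoning
  lemma₁ : ∀ a m b p q → (a + m * b) * (p * q) ≡ a * p * q + m * (b * (p * q))
  lemma₁ = solve-∀
  lemma₂ : ∀ c p i k d → c * p * (1 + i * 2) + 2 * k * (d * p) ≡ (c + 2 * (i * c + k * d)) * p
  lemma₂ = solve-∀
  lemma₃ : ∀ c k p → (c + 2 * (k * c)) * p ≡ c * (p * (1 + k * 2))
  lemma₃ = solve-∀

-- Divisibility by 2

Odd : ℕ → Set
Odd n = ∃ λ m → n ≡ 1 + 2 * m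

odd-* : ∀ {m n} → Odd m → Odd n → Odd (m * n)
odd-* (a , refl) (b , refl) = a + b + 2 * (a * b) , lemma a b
  where
  lemma : ∀ a b → (1 + 2 * a) * (1 + 2 * b) ≡ 1 + 2 * (a + b + 2 * (a * b))
  lemma = solve-∀

odd-+-even : ∀ {m} → Odd m → ∀ n → Odd (m + 2 * n)
odd-+-even (a , refl) n = a + n , cong suc (sym (*-distribˡ-+ 2 a n))

-- At `i = 0` the coefficients are (1;2)_k and (1;2)_{k+1}, products of odd numbers.
coeff₀-odd : ∀ k → Odd (coeff₀ k 0)
coeff₀-odd zero    = 0 , refl
coeff₀-odd (suc k) = odd-* (k , refl) (coeff₀-odd k)

coeff₁-odd : ∀ k → Odd (coeff₁ k 0)
coeff₁-odd zero    = 0 , refl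
coeff₁-odd (suc k) = subst (λ x → Odd (coeff₀ (suc k) 0 + x)) (sym (*-assoc 2 (suc k) (coeff₁ k 0)))
  (odd-+-even (coeff₀-odd (suc k)) (suc k * coeff₁ k 0))

odd⇒¬2∣ : ∀ {n} → Odd n → ¬ 2 ∣ n
odd⇒¬2∣ (m , refl) 2∣n with () ← ∣1⇒≡1 (∣m+n∣m⇒∣n (subst (2 ∣_) (+-comm 1 (2 * m)) 2∣n) (m∣m*n m))

isOrd2 : ∀ e {n} → Odd n → IsOrd2 (2 ^ e * n) e
isOrd2 e {n} n-odd = m∣m*n n , λ e′ 2^e′∣ → ≮⇒≥ (λ e<e′ → odd⇒¬2∣ n-odd
  (*-cancelˡ-∣ (2 ^ e) {{m^n≢0 2 e}} (subst (_∣ 2 ^ e * n) (*-comm 2 (2 ^ e)) (∣-trans (2^-mono e<e′) 2^e′∣))))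
  where
  2^-mono : ∀ {a b} → a ≤ b → 2 ^ a ∣ 2 ^ b
  2^-mono {a} {b} a≤b = subst (2 ^ a ∣_) (trans (sym (^-distribˡ-+-* 2 a (b ∸ a))) (cong (2 ^_) (m+[n∸m]≡n a≤b))) (m∣m*n (2 ^ (b ∸ a)))

∑2^-odd : ∀ k (c : ℕ → ℕ) → Odd (c 0) → Odd (∑< (suc k) (λ i → 2 ^ i * c i))
∑2^-odd k c c0-odd = subst Odd
  (cong₂ _+_ (sym (*-identityˡ (c 0)))
    (trans (sym (∑<-* k 2 (λ i → 2 ^ i * c (suc i)))) (∑<-cong k (λ i → sym (*-assoc 2 (2 ^ i) (c (suc i)))))))
  (odd-+-even c0-odd (∑< k (λ i → 2 ^ i * c (suc i))))

-- Fractions and the theorem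

m<n⇒[m+kn]/n≡k : ∀ {m} k n .{{_ : NonZero n}} → m < n → (m + k * n) / n ≡ k
m<n⇒[m+kn]/n≡k {m} k n m<n = trans (+-distrib-/-∣ʳ m (divides k refl)) (cong₂ _+_ (m<n⇒m/n≡0 m<n) (m*n/n≡m k n))

g-2u+ρ : ∀ u {ρ} → ρ < 2 → g (ρ + u * 2) ≡ γ u ρ
g-2u+ρ u {ρ} ρ<2 = trans (g≡γ (ρ + u * 2))
  (cong₂ γ (m<n⇒[m+kn]/n≡k u 2 ρ<2) (trans ([m+kn]%n≡m%n ρ u 2) (m<n⇒m%n≡m ρ<2)))

/ℚ-cross : ∀ a b m n .{{_ : NonZero m}} .{{_ : NonZero n}} → a * n ≡ b * m → (ℤ.+ a) /ℚ m ≡ (ℤ.+ b) /ℚ n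
/ℚ-cross a b (suc m) (suc n) eq = ℚ.fromℚᵘ-cong {ℚᵘ.mkℚᵘ (ℤ.+ a) m} {ℚᵘ.mkℚᵘ (ℤ.+ b) n}
  (ℚᵘ.*≡* (trans (sym (ℤ.pos-* a (suc n))) (trans (cong ℤ.+_ eq) (ℤ.pos-* b (suc m)))))

/ℚ-* : ∀ a b m n .{{_ : NonZero m}} .{{_ : NonZero n}} → ((ℤ.+ a) /ℚ m) *ℚ ((ℤ.+ b) /ℚ n) ≡ ((ℤ.+ (a * b)) /ℚ (m * n)) {{m*n≢0 m n}}
/ℚ-* a b (suc m) (suc n) = ℚ.toℚᵘ-injective (ℚᵘ.≃-trans
  (ℚ.toℚᵘ-homo-* (fromℚᵘ p) (fromℚᵘ q))
  (ℚᵘ.≃-trans (ℚᵘ.*-cong (ℚ.toℚᵘ-fromℚᵘ p) (ℚ.toℚᵘ-fromℚᵘ q))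
    (ℚᵘ.≃-trans (ℚᵘ.≃-reflexive (cong (λ x → x ℚᵘ./ (suc m * suc n)) (sym (ℤ.pos-* a b))))
      (ℚᵘ.≃-sym (ℚ.toℚᵘ-fromℚᵘ (ℚᵘ.mkℚᵘ (ℤ.+ (a * b)) (n + m * suc n)))))))
  where
  p = ℚᵘ.mkℚᵘ (ℤ.+ a) m
  q = ℚᵘ.mkℚᵘ (ℤ.+ b) n

/ℚ-+ : ∀ a b m .{{_ : NonZero m}} → ((ℤ.+ a) /ℚ m) +ℚ ((ℤ.+ b) /ℚ m) ≡ (ℤ.+ (a + b)) /ℚ m
/ℚ-+ a b (suc m) = ℚ.toℚᵘ-injective (ℚᵘ.≃-trans
  (ℚ.toℚᵘ-homo-+ (fromℚᵘ p) (fromℚᵘ q))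
  (ℚᵘ.≃-trans (ℚᵘ.+-cong (ℚ.toℚᵘ-fromℚᵘ p) (ℚ.toℚᵘ-fromℚᵘ q))
    (ℚᵘ.≃-trans (ℚᵘ.*≡* cross)
      (ℚᵘ.≃-sym (ℚ.toℚᵘ-fromℚᵘ (ℚᵘ.mkℚᵘ (ℤ.+ (a + b)) m))))))
  where
  p = ℚᵘ.mkℚᵘ (ℤ.+ a) m
  q = ℚᵘ.mkℚᵘ (ℤ.+ b) m
  lemma : ∀ a b m → (a * m + b * m) * m ≡ (a + b) * (m * m)
  lemma = solve-∀
  cross : ((ℤ.+ a) ℤ.* (ℤ.+ suc m) ℤ.+ (ℤ.+ b) ℤ.* (ℤ.+ suc m)) ℤ.* (ℤ.+ suc m) ≡ (ℤ.+ (a + b)) ℤ.* (ℤ.+ (suc m * suc m))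
  cross rewrite sym (ℤ.pos-* a (suc m)) | sym (ℤ.pos-* b (suc m)) | sym (ℤ.pos-* (a * suc m + b * suc m) (suc m)) | sym (ℤ.pos-* (a + b) (suc m * suc m))
    = cong ℤ.+_ (lemma a b (suc m))

sumTo-/ℚ : ∀ k m .{{_ : NonZero m}} {f : ℕ → ℚ} {h : ℕ → ℕ} → (∀ i → f i ≡ (ℤ.+ h i) /ℚ m) → sumTo k f ≡ (ℤ.+ ∑< (suc k) h) /ℚ m
sumTo-/ℚ k m {f} {h} eq = go (suc k) id
  where
  -- `upTo` starts from `id` and its tail from `suc`, hence a general `s`.
  go : ∀ n s → foldr _+ℚ_ 0ℚ (map f (applyUpTo s n)) ≡ (ℤ.+ ∑< n (h ∘ s)) /ℚ m
  go zero    s = /ℚ-cross 0 0 1 m refl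
  go (suc n) s = trans (cong₂ _+ℚ_ (eq (s 0)) (go n (s ∘ suc))) (/ℚ-+ (h (s 0)) (∑< n (h ∘ s ∘ suc)) m)

-- The hypothesis says that `d` is the integer c p / q, so every `βterm` becomes a fraction over the
-- common denominator `D`, a power of 2.
product-/ℚ : ∀ a D c p q d x .{{_ : NonZero D}} .{{_ : NonZero q}} → d * q ≡ c * p →
  (((ℤ.+ a) /ℚ D) *ℚ ((ℤ.+ c) /ℚ 1)) *ℚ (((ℤ.+ p) /ℚ q) *ℚ ((ℤ.+ x) /ℚ 1)) ≡ (ℤ.+ (a * (d * x))) /ℚ D
product-/ℚ a D c p q d x eq = trans (cong₂ _*ℚ_ (/ℚ-* a c D 1) (/ℚ-* p x q 1))
  (trans (/ℚ-* (a * c) (p * x) (D * 1) (q * 1) {{m*n≢0 D 1}} {{m*n≢0 q 1}})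
    (/ℚ-cross (a * c * (p * x)) (a * (d * x)) (D * 1 * (q * 1)) D {{m*n≢0 (D * 1) (q * 1) {{m*n≢0 D 1}} {{m*n≢0 q 1}}}}
      (trans (lemma₁ a c p x D) (trans (cong (λ y → a * y * x * D) (sym eq)) (lemma₂ a d q x D)))))
  where
  lemma₁ : ∀ a c p x D → a * c * (p * x) * D ≡ a * (c * p) * x * D
  lemma₁ = solve-∀
  lemma₂ : ∀ a d q x D → a * (d * q) * x * D ≡ a * (d * x) * (D * 1 * (q * 1))
  lemma₂ = solve-∀

t-4k+ρ : ∀ k ρ → t (4 * k + ρ) ≡ 2 ^ (k + 0) * ∑< (suc k) (λ i → 2 ^ i * (coeff₀ k i * γ (2 * i) ρ))
t-4k+ρ k ρ = trans (t≡τ (4 * k + ρ)) (trans (cong τ (lemma k ρ))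
  (trans (sym (matchSum-γ (2 * k) ρ)) (trans (matchSum-even k (λ m → γ m ρ))
    (cong (λ e → 2 ^ e * ∑< (suc k) (λ i → 2 ^ i * (coeff₀ k i * γ (2 * i) ρ))) (sym (+-identityʳ k))))))
  where
  lemma : ∀ k ρ → 4 * k + ρ ≡ 2 * (2 * k) + ρ
  lemma = solve-∀

t-4k+2+ρ : ∀ k ρ → t (4 * k + (2 + ρ)) ≡ 2 ^ (k + 1) * ∑< (suc k) (λ i → 2 ^ i * (coeff₁ k i * γ (suc (2 * i)) ρ))
t-4k+2+ρ k ρ = trans (t≡τ (4 * k + (2 + ρ))) (trans (cong τ (lemma k ρ))
  (trans (sym (matchSum-γ (suc (2 * k)) ρ)) (trans (matchSum-odd k (λ m → γ m ρ))
    (cong (λ e → 2 ^ e * ∑< (suc k) (λ i → 2 ^ i * (coeff₁ k i * γ (suc (2 * i)) ρ))) (sym (+-comm k 1))))))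
  where
  lemma : ∀ k ρ → 4 * k + (2 + ρ) ≡ 2 * suc (2 * k) + ρ
  lemma = solve-∀

g-4i+ρ : ∀ i {ρ} → ρ < 2 → g (4 * i + ρ) ≡ γ (2 * i) ρ
g-4i+ρ i {ρ} ρ<2 = trans (cong g (lemma i ρ)) (g-2u+ρ (2 * i) ρ<2)
  where
  lemma : ∀ i ρ → 4 * i + ρ ≡ ρ + 2 * i * 2
  lemma = solve-∀

g-4i+2+ρ : ∀ i {ρ} → ρ < 2 → g (4 * i + (2 + ρ)) ≡ γ (suc (2 * i)) ρ
g-4i+2+ρ i {ρ} ρ<2 = trans (cong g (lemma i ρ)) (g-2u+ρ (suc (2 * i)) ρ<2)
  where
  lemma : ∀ i ρ → 4 * i + (2 + ρ) ≡ ρ + suc (2 * i) * 2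
  lemma = solve-∀

coeff₀-closed′ : ∀ k i → coeff₀ k i * poch 1 2 (i + 0) ≡ (k C i) * poch 1 2 (k + 0)
coeff₀-closed′ k i rewrite +-identityʳ i | +-identityʳ k = coeff₀-closed k i

coeff₁-closed′ : ∀ k i → coeff₁ k i * poch 1 2 (i + 1) ≡ (k C i) * poch 1 2 (k + 1)
coeff₁-closed′ k i rewrite +-comm i 1 | +-comm k 1 = coeff₁-closed k i

module _ (k r : ℕ) (c h : ℕ → ℕ)
  (c-closed : ∀ i → c i * poch 1 2 (i + r / 2) ≡ (k C i) * poch 1 2 (k + r / 2))
  (g≡h : ∀ i → g (4 * i + r) ≡ h i)
  (t≡ : t (4 * k + r) ≡ 2 ^ (k + r / 2) * ∑< (suc k) (λ i → 2 ^ i * (c i * h i)))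
  where

  -- `x` is the odd part of the sum: the sum itself for `r` below 3, half of it for `r = 3`.
  ord₂-t : ∀ {x} → ∑< (suc k) (λ i → 2 ^ i * (c i * h i)) ≡ 2 ^ δ3 r * x → Odd x →
    IsOrd2 (t (4 * k + r)) (k + r / 2 + δ3 r)
  ord₂-t {x} ∑≡ x-odd = subst (λ n → IsOrd2 n (k + r / 2 + δ3 r)) (begin
    2 ^ (k + r / 2 + δ3 r) * x
      ≡⟨ cong (_* x) (^-distribˡ-+-* 2 (k + r / 2) (δ3 r)) ⟩
    2 ^ (k + r / 2) * 2 ^ δ3 r * x
      ≡⟨ *-assoc (2 ^ (k + r / 2)) (2 ^ δ3 r) x ⟩
    2 ^ (k + r / 2) * (2 ^ δ3 r * x)
      ≡⟨ cong (2 ^ (k + r / 2) *_) (sym ∑≡) ⟩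
    2 ^ (k + r / 2) * ∑< (suc k) (λ i → 2 ^ i * (c i * h i))
      ≡⟨ sym t≡ ⟩
    t (4 * k + r) ∎) (isOrd2 (k + r / 2 + δ3 r) x-odd)
    where open ≡-Reasoning

  βrat≡sumTo : βrat (4 * k + r) (k + r / 2 + δ3 r) ≡ sumTo k (βterm k r)
  βrat≡sumTo = trans
    (/ℚ-cross (t (4 * k + r)) (∑< (suc k) (λ i → 2 ^ i * (c i * h i))) (2 ^ (k + r / 2 + δ3 r)) (2 ^ δ3 r) {{m^n≢0 2 (k + r / 2 + δ3 r)}} {{m^n≢0 2 (δ3 r)}} (begin
      t (4 * k + r) * 2 ^ δ3 r
        ≡⟨ cong (_* 2 ^ δ3 r) t≡ ⟩
      2 ^ (k + r / 2) * S * 2 ^ δ3 r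
        ≡⟨ lemma (2 ^ (k + r / 2)) S (2 ^ δ3 r) ⟩
      S * (2 ^ (k + r / 2) * 2 ^ δ3 r)
        ≡⟨ cong (S *_) (sym (^-distribˡ-+-* 2 (k + r / 2) (δ3 r))) ⟩
      S * 2 ^ (k + r / 2 + δ3 r) ∎))
    (sym (sumTo-/ℚ k (2 ^ δ3 r) {{m^n≢0 2 (δ3 r)}} {h = λ i → 2 ^ i * (c i * h i)} (λ i → trans
      (product-/ℚ (2 ^ i) (2 ^ δ3 r) (k C i) (poch 1 2 (k + r / 2)) (poch 1 2 (i + r / 2)) (c i) (g (4 * i + r))
        {{m^n≢0 2 (δ3 r)}} {{poch12-nonZero (i + r / 2)}} (c-closed i))
      (cong (λ y → ((ℤ.+ (2 ^ i * (c i * y))) /ℚ (2 ^ δ3 r)) {{m^n≢0 2 (δ3 r)}}) (g≡h i)))))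
    where
    open ≡-Reasoning
    S = ∑< (suc k) (λ i → 2 ^ i * (c i * h i))
    lemma : ∀ a s d → a * s * d ≡ s * (a * d)
    lemma = solve-∀

-- The summand 0 is twice an odd number because `γ 1 1 = 2`. Half of the sum is odd once all other
-- summands are divisible by 4; `half i` is a quarter of the summand `suc i`.
∑-r≡3 : ∀ k → ∃ λ x → Odd x × ∑< (suc k) (λ i → 2 ^ i * (coeff₁ k i * γ (suc (2 * i)) 1)) ≡ 2 * x
∑-r≡3 k = coeff₁ k 0 + 2 * ∑< k half , odd-+-even (coeff₁-odd k) (∑< k half) , (begin
  1 * (coeff₁ k 0 * 2) + ∑< k (λ i → 2 ^ suc i * (coeff₁ k (suc i) * γ (suc (2 * suc i)) 1))
    ≡⟨ cong (1 * (coeff₁ k 0 * 2) +_) (trans (∑<-cong k quarter) (∑<-* k 4 half)) ⟩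
  1 * (coeff₁ k 0 * 2) + 4 * ∑< k half
    ≡⟨ lemma (coeff₁ k 0) (∑< k half) ⟩
  2 * (coeff₁ k 0 + 2 * ∑< k half) ∎)
  where
  open ≡-Reasoning
  half : ℕ → ℕ
  half zero    = coeff₁ k 1 * 13
  half (suc i) = 2 ^ i * (coeff₁ k (suc (suc i)) * γ (suc (2 * suc (suc i))) 1)

  lemma : ∀ c y → 1 * (c * 2) + 4 * y ≡ 2 * (c + 2 * y)
  lemma = solve-∀
  lemma₀ : ∀ c → 2 * (c * 26) ≡ 4 * (c * 13)
  lemma₀ = solve-∀
  lemma₁ : ∀ p c → 2 * (2 * p) * c ≡ 4 * (p * c)
  lemma₁ = solve-∀

  -- γ 3 1 = 26 = 2 · 13 supplies the second factor 2 of the term i = 1.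
  quarter : ∀ i → 2 ^ suc i * (coeff₁ k (suc i) * γ (suc (2 * suc i)) 1) ≡ 4 * half i
  quarter zero    = lemma₀ (coeff₁ k 1)
  quarter (suc i) = lemma₁ (2 ^ i) (coeff₁ k (suc (suc i)) * γ (suc (2 * suc (suc i))) 1)

-- The two equations exhibit the quotients of n by 2 and of n + 1 by 4. `δ` is the carry: n + 1
-- reaches the next multiple of 4 exactly when `r = 3`.
floors : ∀ k r {s δ ρ ρ′} → ρ < 2 → r < 4 → ρ′ < 4 →
  4 * k + r ≡ ρ + (2 * k + s) * 2 → 4 * k + r + 1 ≡ ρ′ + (k + δ) * 4 →
  k + s + δ ≡ ((4 * k + r) / 2 ∸ 2 * ((4 * k + r) / 4)) + (4 * k + r + 1) / 4
floors k r {s} {δ} ρ<2 r<4 ρ′<4 eq₂ eq₄ = sym (begin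
  ((4 * k + r) / 2 ∸ 2 * ((4 * k + r) / 4)) + (4 * k + r + 1) / 4
    ≡⟨ cong₂ _+_ (cong₂ (λ x y → x ∸ 2 * y)
         (quotient (2 * k + s) eq₂ ρ<2) (quotient k (trans (+-comm (4 * k) r) (cong (r +_) (*-comm 4 k))) r<4))
         (quotient (k + δ) eq₄ ρ′<4) ⟩
  (2 * k + s ∸ 2 * k) + (k + δ)
    ≡⟨ cong (_+ (k + δ)) (m+n∸m≡n (2 * k) s) ⟩
  s + (k + δ)
    ≡⟨ lemma k s δ ⟩
  k + s + δ ∎)
  where
  open ≡-Reasoning
  quotient : ∀ q {m n ρ} .{{_ : NonZero n}} → m ≡ ρ + q * n → ρ < n → m / n ≡ q
  quotient q {n = n} refl ρ<n = m<n⇒[m+kn]/n≡k q n ρ<n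
  lemma : ∀ k s δ → s + (k + δ) ≡ k + s + δ
  lemma = solve-∀

theorem3p3 : (k r : ℕ) → r < 4 →
    IsOrd2 (t (4 * k + r)) (k + r / 2 + δ3 r)
    × (k + r / 2 + δ3 r ≡ ((4 * k + r) / 2 ∸ 2 * ((4 * k + r) / 4)) + (4 * k + r + 1) / 4)
    × (βrat (4 * k + r) (k + r / 2 + δ3 r) ≡ sumTo k (βterm k r))
theorem3p3 k 0 _ =
    ord₂-t k 0 (coeff₀ k) h (coeff₀-closed′ k) g≡ (t-4k+ρ k 0) (sym (*-identityˡ _))
      -- `(0 , refl)` is the oddness of `h 0`, which computes to 1.
      (∑2^-odd k (λ i → coeff₀ k i * h i) (odd-* (coeff₀-odd k) (0 , refl)))
  , floors k 0 (s≤s z≤n) (s≤s z≤n) (s≤s (s≤s z≤n)) (halves k) (quarters k)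
  , βrat≡sumTo k 0 (coeff₀ k) h (coeff₀-closed′ k) g≡ (t-4k+ρ k 0)
  where
  h : ℕ → ℕ
  h i = γ (2 * i) 0
  g≡ : ∀ i → g (4 * i + 0) ≡ h i
  g≡ i = g-4i+ρ i (s≤s z≤n)
  halves : ∀ k → 4 * k + 0 ≡ 0 + (2 * k + 0) * 2
  halves = solve-∀
  quarters : ∀ k → 4 * k + 0 + 1 ≡ 1 + (k + 0) * 4
  quarters = solve-∀
theorem3p3 k 1 _ =
    ord₂-t k 1 (coeff₀ k) h (coeff₀-closed′ k) g≡ (t-4k+ρ k 1) (sym (*-identityˡ _))
      (∑2^-odd k (λ i → coeff₀ k i * h i) (odd-* (coeff₀-odd k) (0 , refl)))
  , floors k 1 (s≤s (s≤s z≤n)) (s≤s (s≤s z≤n)) (s≤s (s≤s (s≤s z≤n))) (halves k) (quarters k)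
  , βrat≡sumTo k 1 (coeff₀ k) h (coeff₀-closed′ k) g≡ (t-4k+ρ k 1)
  where
  h : ℕ → ℕ
  h i = γ (2 * i) 1
  g≡ : ∀ i → g (4 * i + 1) ≡ h i
  g≡ i = g-4i+ρ i (s≤s (s≤s z≤n))
  halves : ∀ k → 4 * k + 1 ≡ 1 + (2 * k + 0) * 2
  halves = solve-∀
  quarters : ∀ k → 4 * k + 1 + 1 ≡ 2 + (k + 0) * 4
  quarters = solve-∀
theorem3p3 k 2 _ =
    ord₂-t k 2 (coeff₁ k) h (coeff₁-closed′ k) g≡ (t-4k+2+ρ k 0) (sym (*-identityˡ _))
      (∑2^-odd k (λ i → coeff₁ k i * h i) (odd-* (coeff₁-odd k) (0 , refl)))
  , floors k 2 (s≤s z≤n) (s≤s (s≤s (s≤s z≤n))) (s≤s (s≤s (s≤s (s≤s z≤n)))) (halves k) (quarters k)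
  , βrat≡sumTo k 2 (coeff₁ k) h (coeff₁-closed′ k) g≡ (t-4k+2+ρ k 0)
  where
  h : ℕ → ℕ
  h i = γ (suc (2 * i)) 0
  g≡ : ∀ i → g (4 * i + 2) ≡ h i
  g≡ i = g-4i+2+ρ i (s≤s z≤n)
  halves : ∀ k → 4 * k + 2 ≡ 0 + (2 * k + 1) * 2
  halves = solve-∀
  quarters : ∀ k → 4 * k + 2 + 1 ≡ 3 + (k + 0) * 4
  quarters = solve-∀
theorem3p3 k 3 _ =
    -- Here `h 0` is 2, so the odd number comes from half of the sum.
    ord₂-t k 3 (coeff₁ k) h (coeff₁-closed′ k) g≡ (t-4k+2+ρ k 1) ∑≡2x x-odd
  , floors k 3 (s≤s (s≤s z≤n)) (s≤s (s≤s (s≤s (s≤s z≤n)))) (s≤s z≤n) (halves k) (quarters k)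
  , βrat≡sumTo k 3 (coeff₁ k) h (coeff₁-closed′ k) g≡ (t-4k+2+ρ k 1)
  where
  h : ℕ → ℕ
  h i = γ (suc (2 * i)) 1
  x-odd = proj₁ (proj₂ (∑-r≡3 k))
  ∑≡2x  = proj₂ (proj₂ (∑-r≡3 k))
  g≡ : ∀ i → g (4 * i + 3) ≡ h i
  g≡ i = g-4i+2+ρ i (s≤s (s≤s z≤n))
  halves : ∀ k → 4 * k + 3 ≡ 1 + (2 * k + 1) * 2
  halves = solve-∀
  quarters : ∀ k → 4 * k + 3 + 1 ≡ 0 + (k + 1) * 4
  quarters = solve-∀
theorem3p3 k (suc (suc (suc (suc r)))) (s≤s (s≤s (s≤s (s≤s ()))))
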